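{- We have \[ (n-1)P_{n-1}(y)=P'_{n-1}(y)-P'_n(y)\quad(n\ge1),\qquad (n-1)Q_{n-1}(y)=Q'_{n-1}(y)-Q'_n(y)\quad(n\ge2). \]
   Context: Let $A$ be the ring of formal series $\sum_{n\ge0}q_n(y)x^{ -n}$, each $q_n$ a complex polynomial of degree at most $n$, with termwise formal derivatives $a_x=-\sum_{n\ge1}nq_n(y)x^{ -n-1}$, $a_y=\sum_{n\ge1}q_n'(y)x^{ -n}$, and $\log(1+u)=\sum_{k\ge1}(-1)^{k+1}u^k/k$ for $u$ with zero constant term. Let $V\in A$ be the unique solution of $V=1+\frac{y}{x}-\frac{1}{x}V-V_x-\frac{1}{x}V_y+\frac{1}{x}\log V$, and define polynomials $P_{n-1}$ ($n\ge1$) and $Q_n$ ($n\ge1$) by $V=1+\sum_{n\ge1}P_{n-1}(y)x^{ -n}$ and $\log V=\sum_{n\ge1}Q_n(y)x^{ -n}$ (so $P_0=y-1$). Primes denote derivatives in $y$. -}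

module Defs where

open import Algebra.Bundles using (CommutativeRing; RawRing; Semiring)
import Algebra.Definitions.RawSemiring as RawSemiringDefs
import Algebra.Properties.Ring as RingProperties
import Data.Fin.Properties as Fin
open import Data.Fin.Base using (Fin; toℕ) renaming (zero to fzero; suc to fsuc)
open import Data.Integer.Base as ℤ using (+_)
import Data.Integer.Properties as ℤ
open import Data.Nat.Base as ℕ using (ℕ; zero; suc; NonZero; _∸_)
import Data.Nat.Properties as ℕ
open import Data.Product.Base using (_×_; _,_; proj₁; proj₂; ∃-syntax)
open import Data.Rational.Base as ℚ using (ℚ; 0ℚ; 1ℚ; ½; ∣_∣)
import Data.Rational.Properties as ℚ
open import Data.Rational.Solver using (module +-*-Solver)
import Data.Rational.Unnormalised.Base as ℚᵘ
import Data.Rational.Unnormalised.Properties as ℚᵘ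
open import Level using (0ℓ; _⊔_)
open import Relation.Binary.PropositionalEquality.Core using (_≡_; refl; sym; trans; cong; cong₂; subst)
open import Relation.Nullary.Decidable.Core using (yes; no)

-- Real numbers are Cauchy sequences of rationals, equal when their difference
-- tends to 0

IsCauchy : (ℕ → ℚ) → Set
IsCauchy s = ∀ ε → 0ℚ ℚ.< ε →
  ∃[ N ] (∀ m n → N ℕ.≤ m → N ℕ.≤ n → ∣ s m ℚ.- s n ∣ ℚ.< ε)

IsNull : (ℕ → ℚ) → Set
IsNull s = ∀ ε → 0ℚ ℚ.< ε → ∃[ N ] (∀ n → N ℕ.≤ n → ∣ s n ∣ ℚ.< ε)

record ℝ : Set where
  constructor mkℝ
  field
    seq      : ℕ → ℚ
    isCauchy : IsCauchy seq

open ℝ public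

infix 4 _≃_

_≃_ : ℝ → ℝ → Set
x ≃ y = IsNull (λ n → seq x n ℚ.- seq y n)

private
  module S = +-*-Solver

  ½ε>0 : ∀ {ε} → 0ℚ ℚ.< ε → 0ℚ ℚ.< ½ ℚ.* ε
  ½ε>0 {ε} ε>0 = ℚ.positive⁻¹ (½ ℚ.* ε) {{ℚ.pos*pos⇒pos ½ ε {{ℚ.positive ε>0}}}}

  ½+½ : ∀ ε → ½ ℚ.* ε ℚ.+ ½ ℚ.* ε ≡ ε
  ½+½ ε = trans (sym (ℚ.*-distribʳ-+ ε ½ ½)) (ℚ.*-identityˡ ε)

  small+small : ∀ {ε} a b → ∣ a ∣ ℚ.< ½ ℚ.* ε → ∣ b ∣ ℚ.< ½ ℚ.* ε → ∣ a ℚ.+ b ∣ ℚ.< ε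
  small+small {ε} a b p q = begin-strict
    ∣ a ℚ.+ b ∣             ≤⟨ ℚ.∣p+q∣≤∣p∣+∣q∣ a b ⟩
    ∣ a ∣ ℚ.+ ∣ b ∣         <⟨ ℚ.+-mono-< p q ⟩
    ½ ℚ.* ε ℚ.+ ½ ℚ.* ε     ≡⟨ ½+½ ε ⟩
    ε                       ∎
    where open ℚ.≤-Reasoning

  module Scale (B : ℚ) (B>0 : 0ℚ ℚ.< B) where
    instance
      B-pos : ℚ.Positive B
      B-pos = ℚ.positive B>0

      B-nonZero : ℚ.NonZero B
      B-nonZero = ℚ.pos⇒nonZero B

    shrink : ℚ → ℚ
    shrink ε = ε ℚ.* (ℚ.1/ B)

    shrink>0 : ∀ {ε} → 0ℚ ℚ.< ε → 0ℚ ℚ.< shrink ε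
    shrink>0 {ε} ε>0 = ℚ.positive⁻¹ (shrink ε)
      {{ℚ.pos*pos⇒pos ε {{ℚ.positive ε>0}} (ℚ.1/ B) {{ℚ.1/pos⇒pos B}}}}

    small*bounded : ∀ {ε} a b → ∣ a ∣ ℚ.< shrink ε → ∣ b ∣ ℚ.≤ B → ∣ a ℚ.* b ∣ ℚ.< ε
    small*bounded {ε} a b p q = begin-strict
      ∣ a ℚ.* b ∣             ≡⟨ ℚ.∣p*q∣≡∣p∣*∣q∣ a b ⟩
      ∣ a ∣ ℚ.* ∣ b ∣         ≤⟨ ℚ.*-monoˡ-≤-nonNeg ∣ a ∣ {{ℚ.nonNegative (ℚ.0≤∣p∣ a)}} q ⟩
      ∣ a ∣ ℚ.* B             <⟨ ℚ.*-monoˡ-<-pos B p ⟩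
      (ε ℚ.* (ℚ.1/ B)) ℚ.* B  ≡⟨ ℚ.*-assoc ε (ℚ.1/ B) B ⟩
      ε ℚ.* ((ℚ.1/ B) ℚ.* B)  ≡⟨ cong (ε ℚ.*_) (ℚ.*-inverseˡ B) ⟩
      ε ℚ.* 1ℚ                ≡⟨ ℚ.*-identityʳ ε ⟩
      ε                       ∎
      where open ℚ.≤-Reasoning

  bounded : ∀ x → ∃[ B ] (0ℚ ℚ.< B × ∃[ N ] (∀ n → N ℕ.≤ n → ∣ seq x n ∣ ℚ.≤ B))
  bounded x with isCauchy x 1ℚ (ℚ.positive⁻¹ 1ℚ)
  ... | N , close = B , B>0 , N , bound
    where
    open ℚ.≤-Reasoning
    B = 1ℚ ℚ.+ ∣ seq x N ∣
    B>0 : 0ℚ ℚ.< B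
    B>0 = ℚ.+-mono-<-≤ (ℚ.positive⁻¹ 1ℚ) (ℚ.0≤∣p∣ (seq x N))
    bound : ∀ n → N ℕ.≤ n → ∣ seq x n ∣ ℚ.≤ B
    bound n N≤n = begin
      ∣ seq x n ∣
        ≡⟨ cong ∣_∣ (S.solve 2 (λ a b → a S.:= (a S.:- b) S.:+ b) refl (seq x n) (seq x N)) ⟩
      ∣ (seq x n ℚ.- seq x N) ℚ.+ seq x N ∣
        ≤⟨ ℚ.∣p+q∣≤∣p∣+∣q∣ (seq x n ℚ.- seq x N) (seq x N) ⟩
      ∣ seq x n ℚ.- seq x N ∣ ℚ.+ ∣ seq x N ∣
        ≤⟨ ℚ.+-monoˡ-≤ ∣ seq x N ∣ (ℚ.<⇒≤ (close n N N≤n ℕ.≤-refl)) ⟩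
      B ∎

  null-+ : ∀ {s t} → IsNull s → IsNull t → IsNull (λ n → s n ℚ.+ t n)
  null-+ {s} {t} p q ε ε>0 with p (½ ℚ.* ε) (½ε>0 ε>0) | q (½ ℚ.* ε) (½ε>0 ε>0)
  ... | M , f | N , g = M ℕ.⊔ N , λ n h → small+small (s n) (t n)
    (f n (ℕ.≤-trans (ℕ.m≤m⊔n M N) h)) (g n (ℕ.≤-trans (ℕ.m≤n⊔m M N) h))

  null-* : ∀ {s} x → IsNull s → IsNull (λ n → s n ℚ.* seq x n)
  null-* {s} x p ε ε>0 = go (bounded x)
    where
    go : ∃[ B ] (0ℚ ℚ.< B × ∃[ N ] (∀ n → N ℕ.≤ n → ∣ seq x n ∣ ℚ.≤ B)) →
         ∃[ N ] (∀ n → N ℕ.≤ n → ∣ s n ℚ.* seq x n ∣ ℚ.< ε)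
    go (B , B>0 , N , b) = M ℕ.⊔ N , λ n h → small*bounded (s n) (seq x n)
        (proj₂ small n (ℕ.≤-trans (ℕ.m≤m⊔n M N) h)) (b n (ℕ.≤-trans (ℕ.m≤n⊔m M N) h))
      where
      open Scale B B>0
      small = p (shrink ε) (shrink>0 ε>0)
      M = proj₁ small

  null-≗ : ∀ {s t} → (∀ n → s n ≡ t n) → IsNull s → IsNull t
  null-≗ e p ε ε>0 with p ε ε>0
  ... | N , f = N , λ n h → subst (λ z → ∣ z ∣ ℚ.< ε) (e n) (f n h)

  null-neg : ∀ {s} → IsNull s → IsNull (λ n → ℚ.- s n)
  null-neg {s} p ε ε>0 with p ε ε>0
  ... | N , f = N , λ n h → subst (ℚ._< ε) (sym (ℚ.∣-p∣≡∣p∣ (s n))) (f n h)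

  ≗⇒≃ : ∀ x y → (∀ n → seq x n ≡ seq y n) → x ≃ y
  ≗⇒≃ x y e ε ε>0 = 0 , λ n _ → subst (λ z → ∣ z ∣ ℚ.< ε)
    (sym (trans (cong (ℚ._- seq y n) (e n)) (ℚ.+-inverseʳ (seq y n)))) ε>0

infixl 6 _+ℝ_
infixl 7 _*ℝ_
infix  8 -ℝ_

constℝ : ℚ → ℝ
constℝ r = mkℝ (λ _ → r) λ ε ε>0 → 0 , λ _ _ _ _ →
  subst (λ z → ∣ z ∣ ℚ.< ε) (sym (ℚ.+-inverseʳ r)) ε>0

_+ℝ_ : ℝ → ℝ → ℝ
x +ℝ y = mkℝ (λ n → seq x n ℚ.+ seq y n) cauchy
  where
  cauchy : IsCauchy (λ n → seq x n ℚ.+ seq y n)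
  cauchy ε ε>0 with isCauchy x (½ ℚ.* ε) (½ε>0 ε>0) | isCauchy y (½ ℚ.* ε) (½ε>0 ε>0)
  ... | M , f | N , g = M ℕ.⊔ N , λ m n hm hn → subst (λ z → ∣ z ∣ ℚ.< ε)
    (S.solve 4 (λ a b c d → (a S.:- b) S.:+ (c S.:- d) S.:= (a S.:+ c) S.:- (b S.:+ d)) refl
      (seq x m) (seq x n) (seq y m) (seq y n))
    (small+small (seq x m ℚ.- seq x n) (seq y m ℚ.- seq y n)
      (f m n (ℕ.≤-trans (ℕ.m≤m⊔n M N) hm) (ℕ.≤-trans (ℕ.m≤m⊔n M N) hn))
      (g m n (ℕ.≤-trans (ℕ.m≤n⊔m M N) hm) (ℕ.≤-trans (ℕ.m≤n⊔m M N) hn)))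

-ℝ_ : ℝ → ℝ
-ℝ x = mkℝ (λ n → ℚ.- seq x n) cauchy
  where
  cauchy : IsCauchy (λ n → ℚ.- seq x n)
  cauchy ε ε>0 with isCauchy x ε ε>0
  ... | N , f = N , λ m n hm hn → subst (λ z → ∣ z ∣ ℚ.< ε)
    (S.solve 2 (λ a b → b S.:- a S.:= (S.:- a) S.:- (S.:- b)) refl (seq x m) (seq x n))
    (f n m hn hm)

_*ℝ_ : ℝ → ℝ → ℝ
x *ℝ y = mkℝ (λ n → seq x n ℚ.* seq y n) cauchy
  where
  cauchy : IsCauchy (λ n → seq x n ℚ.* seq y n)
  cauchy ε ε>0 = go (bounded x) (bounded y)
    where
    go : ∃[ A ] (0ℚ ℚ.< A × ∃[ K ] (∀ n → K ℕ.≤ n → ∣ seq x n ∣ ℚ.≤ A)) →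
         ∃[ B ] (0ℚ ℚ.< B × ∃[ L ] (∀ n → L ℕ.≤ n → ∣ seq y n ∣ ℚ.≤ B)) →
         ∃[ N ] (∀ m n → N ℕ.≤ m → N ℕ.≤ n → ∣ seq x m ℚ.* seq y m ℚ.- seq x n ℚ.* seq y n ∣ ℚ.< ε)
    go (A , A>0 , K , a) (B , B>0 , L , b) = (K ℕ.⊔ L) ℕ.⊔ (M ℕ.⊔ N) , λ m n hm hn →
      subst (λ z → ∣ z ∣ ℚ.< ε)
        (S.solve 4 (λ a b c d →
            (a S.:- b) S.:* c S.:+ (c S.:- d) S.:* b S.:= a S.:* c S.:- b S.:* d) refl
          (seq x m) (seq x n) (seq y m) (seq y n))
        (small+small ((seq x m ℚ.- seq x n) ℚ.* seq y m) ((seq y m ℚ.- seq y n) ℚ.* seq x n)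
          (SB.small*bounded (seq x m ℚ.- seq x n) (seq y m)
            (proj₂ smallx m n (ℕ.≤-trans M≤ hm) (ℕ.≤-trans M≤ hn)) (b m (ℕ.≤-trans L≤ hm)))
          (SA.small*bounded (seq y m ℚ.- seq y n) (seq x n)
            (proj₂ smally m n (ℕ.≤-trans N≤ hm) (ℕ.≤-trans N≤ hn)) (a n (ℕ.≤-trans K≤ hn))))
      where
      module SA = Scale A A>0
      module SB = Scale B B>0
      smallx = isCauchy x (SB.shrink (½ ℚ.* ε)) (SB.shrink>0 (½ε>0 ε>0))
      smally = isCauchy y (SA.shrink (½ ℚ.* ε)) (SA.shrink>0 (½ε>0 ε>0))
      M = proj₁ smallx
      N = proj₁ smally
      l = ℕ.m≤m⊔n (K ℕ.⊔ L) (M ℕ.⊔ N)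
      r = ℕ.m≤n⊔m (K ℕ.⊔ L) (M ℕ.⊔ N)
      K≤ = ℕ.≤-trans (ℕ.m≤m⊔n K L) l
      L≤ = ℕ.≤-trans (ℕ.m≤n⊔m K L) l
      M≤ = ℕ.≤-trans (ℕ.m≤m⊔n M N) r
      N≤ = ℕ.≤-trans (ℕ.m≤n⊔m M N) r

private
  ≃-refl : ∀ {x} → x ≃ x
  ≃-refl {x} = ≗⇒≃ x x (λ _ → refl)

  ≃-sym : ∀ {x y} → x ≃ y → y ≃ x
  ≃-sym {x} {y} p = null-≗
    (λ n → S.solve 2 (λ a b → S.:- (a S.:- b) S.:= b S.:- a) refl (seq x n) (seq y n))
    (null-neg p)

  ≃-trans : ∀ {x y z} → x ≃ y → y ≃ z → x ≃ z
  ≃-trans {x} {y} {z} p q = null-≗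
    (λ n → S.solve 3 (λ a b c → (a S.:- b) S.:+ (b S.:- c) S.:= a S.:- c) refl
      (seq x n) (seq y n) (seq z n))
    (null-+ p q)

  +ℝ-cong : ∀ {x x′ y y′} → x ≃ x′ → y ≃ y′ → x +ℝ y ≃ x′ +ℝ y′
  +ℝ-cong {x} {x′} {y} {y′} p q = null-≗
    (λ n → S.solve 4 (λ a b c d → (a S.:- b) S.:+ (c S.:- d) S.:= (a S.:+ c) S.:- (b S.:+ d)) refl
      (seq x n) (seq x′ n) (seq y n) (seq y′ n))
    (null-+ p q)

  -ℝ-cong : ∀ {x y} → x ≃ y → -ℝ x ≃ -ℝ y
  -ℝ-cong {x} {y} p = null-≗
    (λ n → S.solve 2 (λ a b → S.:- (a S.:- b) S.:= (S.:- a) S.:- (S.:- b)) refl (seq x n) (seq y n))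
    (null-neg p)

  *ℝ-cong : ∀ {x x′ y y′} → x ≃ x′ → y ≃ y′ → x *ℝ y ≃ x′ *ℝ y′
  *ℝ-cong {x} {x′} {y} {y′} p q = null-≗
    (λ n → S.solve 4 (λ a b c d →
        (a S.:- b) S.:* c S.:+ (c S.:- d) S.:* b S.:= a S.:* c S.:- b S.:* d) refl
      (seq x n) (seq x′ n) (seq y n) (seq y′ n))
    (null-+ (null-* y p) (null-* x′ q))

record ℂ : Set where
  constructor _+i_
  field
    re im : ℝ

open ℂ public

infix 4 _≈ℂ_
infixl 6 _+ℂ_
infixl 7 _*ℂ_
infix  8 -ℂ_

_≈ℂ_ : ℂ → ℂ → Set
z ≈ℂ w = re z ≃ re w × im z ≃ im w

fromℚ : ℚ → ℂ
fromℚ r = constℝ r +i constℝ 0ℚ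

_+ℂ_ : ℂ → ℂ → ℂ
z +ℂ w = (re z +ℝ re w) +i (im z +ℝ im w)

-ℂ_ : ℂ → ℂ
-ℂ z = (-ℝ re z) +i (-ℝ im z)

_*ℂ_ : ℂ → ℂ → ℂ
z *ℂ w = (re z *ℝ re w +ℝ -ℝ (im z *ℝ im w)) +i (re z *ℝ im w +ℝ im z *ℝ re w)

private
  -- the ring laws hold at every index of the approximating sequences
  termwise : ∀ z w → (∀ n → seq (re z) n ≡ seq (re w) n) → (∀ n → seq (im z) n ≡ seq (im w) n) → z ≈ℂ w
  termwise z w p q = ≗⇒≃ (re z) (re w) p , ≗⇒≃ (im z) (im w) q

  ℂ-refl : ∀ {z} → z ≈ℂ z
  ℂ-refl {z} = ≃-refl {re z} , ≃-refl {im z}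

  ℂ-sym : ∀ {z w} → z ≈ℂ w → w ≈ℂ z
  ℂ-sym {z} {w} (p , q) = ≃-sym {re z} {re w} p , ≃-sym {im z} {im w} q

  ℂ-trans : ∀ {z w v} → z ≈ℂ w → w ≈ℂ v → z ≈ℂ v
  ℂ-trans {z} {w} {v} (p , q) (r , s) =
    ≃-trans {re z} {re w} {re v} p r , ≃-trans {im z} {im w} {im v} q s

  +ℂ-cong : ∀ {z z′ w w′} → z ≈ℂ z′ → w ≈ℂ w′ → z +ℂ w ≈ℂ z′ +ℂ w′
  +ℂ-cong {z} {z′} {w} {w′} (p , q) (r , s) =
    +ℝ-cong {re z} {re z′} {re w} {re w′} p r , +ℝ-cong {im z} {im z′} {im w} {im w′} q s

  -ℂ-cong : ∀ {z w} → z ≈ℂ w → -ℂ z ≈ℂ -ℂ w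
  -ℂ-cong {z} {w} (p , q) = -ℝ-cong {re z} {re w} p , -ℝ-cong {im z} {im w} q

  *ℂ-cong : ∀ {z z′ w w′} → z ≈ℂ z′ → w ≈ℂ w′ → z *ℂ w ≈ℂ z′ *ℂ w′
  *ℂ-cong {a +i b} {a′ +i b′} {c +i d} {c′ +i d′} (p , q) (r , s) =
    +ℝ-cong {a *ℝ c} {a′ *ℝ c′} { -ℝ (b *ℝ d)} { -ℝ (b′ *ℝ d′)}
      (*ℝ-cong {a} {a′} {c} {c′} p r)
      (-ℝ-cong {b *ℝ d} {b′ *ℝ d′} (*ℝ-cong {b} {b′} {d} {d′} q s)) ,
    +ℝ-cong {a *ℝ d} {a′ *ℝ d′} {b *ℝ c} {b′ *ℝ c′}
      (*ℝ-cong {a} {a′} {d} {d′} p s) (*ℝ-cong {b} {b′} {c} {c′} q r)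

  +ℂ-assoc : ∀ x y z → (x +ℂ y) +ℂ z ≈ℂ x +ℂ (y +ℂ z)
  +ℂ-assoc x y z = termwise ((x +ℂ y) +ℂ z) (x +ℂ (y +ℂ z))
    (λ n → ℚ.+-assoc (seq (re x) n) (seq (re y) n) (seq (re z) n))
    (λ n → ℚ.+-assoc (seq (im x) n) (seq (im y) n) (seq (im z) n))

  +ℂ-comm : ∀ x y → x +ℂ y ≈ℂ y +ℂ x
  +ℂ-comm x y = termwise (x +ℂ y) (y +ℂ x)
    (λ n → ℚ.+-comm (seq (re x) n) (seq (re y) n))
    (λ n → ℚ.+-comm (seq (im x) n) (seq (im y) n))

  +ℂ-identityˡ : ∀ x → fromℚ 0ℚ +ℂ x ≈ℂ x
  +ℂ-identityˡ x = termwise (fromℚ 0ℚ +ℂ x) x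
    (λ n → ℚ.+-identityˡ (seq (re x) n)) (λ n → ℚ.+-identityˡ (seq (im x) n))

  +ℂ-inverseˡ : ∀ x → (-ℂ x) +ℂ x ≈ℂ fromℚ 0ℚ
  +ℂ-inverseˡ x = termwise ((-ℂ x) +ℂ x) (fromℚ 0ℚ)
    (λ n → ℚ.+-inverseˡ (seq (re x) n)) (λ n → ℚ.+-inverseˡ (seq (im x) n))

  *ℂ-comm : ∀ x y → x *ℂ y ≈ℂ y *ℂ x
  *ℂ-comm x y = termwise (x *ℂ y) (y *ℂ x)
    (λ n → S.solve 4 (λ a b c d → a S.:* c S.:+ S.:- (b S.:* d) S.:= c S.:* a S.:+ S.:- (d S.:* b)) refl
      (seq (re x) n) (seq (im x) n) (seq (re y) n) (seq (im y) n))
    (λ n → S.solve 4 (λ a b c d → a S.:* d S.:+ b S.:* c S.:= c S.:* b S.:+ d S.:* a) refl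
      (seq (re x) n) (seq (im x) n) (seq (re y) n) (seq (im y) n))

  *ℂ-assoc : ∀ x y z → (x *ℂ y) *ℂ z ≈ℂ x *ℂ (y *ℂ z)
  *ℂ-assoc x y z = termwise ((x *ℂ y) *ℂ z) (x *ℂ (y *ℂ z))
    (λ n → S.solve 6 (λ a b c d e f →
        (a S.:* c S.:+ S.:- (b S.:* d)) S.:* e S.:+ S.:- ((a S.:* d S.:+ b S.:* c) S.:* f)
        S.:= a S.:* (c S.:* e S.:+ S.:- (d S.:* f)) S.:+ S.:- (b S.:* (c S.:* f S.:+ d S.:* e))) refl
      (seq (re x) n) (seq (im x) n) (seq (re y) n) (seq (im y) n) (seq (re z) n) (seq (im z) n))
    (λ n → S.solve 6 (λ a b c d e f →
        (a S.:* c S.:+ S.:- (b S.:* d)) S.:* f S.:+ (a S.:* d S.:+ b S.:* c) S.:* e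
        S.:= a S.:* (c S.:* f S.:+ d S.:* e) S.:+ b S.:* (c S.:* e S.:+ S.:- (d S.:* f))) refl
      (seq (re x) n) (seq (im x) n) (seq (re y) n) (seq (im y) n) (seq (re z) n) (seq (im z) n))

  *ℂ-identityˡ : ∀ x → fromℚ 1ℚ *ℂ x ≈ℂ x
  *ℂ-identityˡ x = termwise (fromℚ 1ℚ *ℂ x) x
    (λ n → S.solve 2 (λ a b → S.con 1ℚ S.:* a S.:+ S.:- (S.con 0ℚ S.:* b) S.:= a) refl
      (seq (re x) n) (seq (im x) n))
    (λ n → S.solve 2 (λ a b → S.con 1ℚ S.:* b S.:+ S.con 0ℚ S.:* a S.:= b) refl
      (seq (re x) n) (seq (im x) n))

  *ℂ-distribˡ : ∀ x y z → x *ℂ (y +ℂ z) ≈ℂ x *ℂ y +ℂ x *ℂ z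
  *ℂ-distribˡ x y z = termwise (x *ℂ (y +ℂ z)) (x *ℂ y +ℂ x *ℂ z)
    (λ n → S.solve 6 (λ a b c d e f →
        a S.:* (c S.:+ e) S.:+ S.:- (b S.:* (d S.:+ f))
        S.:= (a S.:* c S.:+ S.:- (b S.:* d)) S.:+ (a S.:* e S.:+ S.:- (b S.:* f))) refl
      (seq (re x) n) (seq (im x) n) (seq (re y) n) (seq (im y) n) (seq (re z) n) (seq (im z) n))
    (λ n → S.solve 6 (λ a b c d e f →
        a S.:* (d S.:+ f) S.:+ b S.:* (c S.:+ e)
        S.:= (a S.:* d S.:+ b S.:* c) S.:+ (a S.:* f S.:+ b S.:* e)) refl
      (seq (re x) n) (seq (im x) n) (seq (re y) n) (seq (im y) n) (seq (re z) n) (seq (im z) n))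

  viaComm : ∀ {a b c d} → b ≈ℂ a → b ≈ℂ c → c ≈ℂ d → a ≈ℂ d
  viaComm {a} {b} {c} {d} p q r =
    ℂ-trans {a} {b} {d} (ℂ-sym {b} {a} p) (ℂ-trans {b} {c} {d} q r)

ℂ-commutativeRing : CommutativeRing 0ℓ 0ℓ
ℂ-commutativeRing = record
  { Carrier = ℂ ; _≈_ = _≈ℂ_ ; _+_ = _+ℂ_ ; _*_ = _*ℂ_ ; -_ = -ℂ_
  ; 0# = fromℚ 0ℚ ; 1# = fromℚ 1ℚ
  ; isCommutativeRing = record
    { isRing = record
      { +-isAbelianGroup = record
        { isGroup = record
          { isMonoid = record
            { isSemigroup = record
              { isMagma = record
                { isEquivalence = record
                  { refl  = λ {x} → ℂ-refl {x}
                  ; sym   = λ {x} {y} → ℂ-sym {x} {y}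
                  ; trans = λ {x} {y} {z} → ℂ-trans {x} {y} {z} }
                ; ∙-cong = λ {x} {y} {u} {v} → +ℂ-cong {x} {y} {u} {v} }
              ; assoc = +ℂ-assoc }
            ; identity = +ℂ-identityˡ , λ x →
                viaComm {x +ℂ 0ℂ} {0ℂ +ℂ x} {x} {x} (+ℂ-comm 0ℂ x) (+ℂ-identityˡ x) (ℂ-refl {x}) }
          ; inverse = +ℂ-inverseˡ , λ x →
              viaComm {x +ℂ (-ℂ x)} {(-ℂ x) +ℂ x} {0ℂ} {0ℂ} (+ℂ-comm (-ℂ x) x) (+ℂ-inverseˡ x) (ℂ-refl {0ℂ})
          ; ⁻¹-cong = λ {x} {y} → -ℂ-cong {x} {y} }
        ; comm = +ℂ-comm }
      ; *-cong = λ {x} {y} {u} {v} → *ℂ-cong {x} {y} {u} {v}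
      ; *-assoc = *ℂ-assoc
      ; *-identity = *ℂ-identityˡ , λ x →
          viaComm {x *ℂ 1ℂ} {1ℂ *ℂ x} {x} {x} (*ℂ-comm 1ℂ x) (*ℂ-identityˡ x) (ℂ-refl {x})
      ; distrib = *ℂ-distribˡ , λ x y z →
          viaComm {(y +ℂ z) *ℂ x} {x *ℂ (y +ℂ z)} {x *ℂ y +ℂ x *ℂ z} {y *ℂ x +ℂ z *ℂ x}
            (*ℂ-comm x (y +ℂ z)) (*ℂ-distribˡ x y z)
            (+ℂ-cong {x *ℂ y} {y *ℂ x} {x *ℂ z} {z *ℂ x} (*ℂ-comm x y) (*ℂ-comm x z)) }
    ; *-comm = *ℂ-comm } }
  where
  0ℂ = fromℚ 0ℚ
  1ℂ = fromℚ 1ℚ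

recipℂ : ∀ k → .{{NonZero k}} → ℂ
recipℂ k = fromℚ (+ 1 ℚ./ k)

private
  module Mℂ = RawSemiringDefs (Semiring.rawSemiring (CommutativeRing.semiring ℂ-commutativeRing))

  re-multiple : ∀ k n → seq (re (k Mℂ.× fromℚ 1ℚ)) n ≡ + k ℚ./ 1
  re-multiple zero    n = refl
  re-multiple (suc k) n = trans (cong (1ℚ ℚ.+_) (re-multiple k n)) (ℚ.toℚᵘ-injective (begin
    ℚ.toℚᵘ (1ℚ ℚ.+ (+ k ℚ./ 1))           ≈⟨ ℚ.toℚᵘ-homo-+ 1ℚ (+ k ℚ./ 1) ⟩
    ℚᵘ.1ℚᵘ ℚᵘ.+ ℚ.toℚᵘ (+ k ℚ./ 1)        ≈⟨ ℚᵘ.+-congʳ ℚᵘ.1ℚᵘ (ℚ.toℚᵘ-fromℚᵘ (+ k ℚᵘ./ 1)) ⟩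
    ℚᵘ.1ℚᵘ ℚᵘ.+ (+ k ℚᵘ./ 1)              ≈⟨ ℚᵘ.*≡* (cong (ℤ._* + 1) (cong (λ z → + 1 ℤ.+ z) (ℤ.*-identityʳ (+ k)))) ⟩
    + suc k ℚᵘ./ 1                        ≈⟨ ℚ.toℚᵘ-fromℚᵘ (+ suc k ℚᵘ./ 1) ⟨
    ℚ.toℚᵘ (+ suc k ℚ./ 1)                ∎))
    where open ℚᵘ.≃-Reasoning

  im-multiple : ∀ k n → seq (im (k Mℂ.× fromℚ 1ℚ)) n ≡ 0ℚ
  im-multiple zero    n = refl
  im-multiple (suc k) n = trans (cong (0ℚ ℚ.+_) (im-multiple k n)) refl

  k*1/k : ∀ k → (+ suc k ℚ./ 1) ℚ.* (+ 1 ℚ./ suc k) ≡ 1ℚ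
  k*1/k k = ℚ.toℚᵘ-injective (begin
    ℚ.toℚᵘ ((+ suc k ℚ./ 1) ℚ.* (+ 1 ℚ./ suc k))
      ≈⟨ ℚ.toℚᵘ-homo-* (+ suc k ℚ./ 1) (+ 1 ℚ./ suc k) ⟩
    ℚ.toℚᵘ (+ suc k ℚ./ 1) ℚᵘ.* ℚ.toℚᵘ (+ 1 ℚ./ suc k)
      ≈⟨ ℚᵘ.*-cong (ℚ.toℚᵘ-fromℚᵘ (+ suc k ℚᵘ./ 1)) (ℚ.toℚᵘ-fromℚᵘ (+ 1 ℚᵘ./ suc k)) ⟩
    (+ suc k ℚᵘ./ 1) ℚᵘ.* (+ 1 ℚᵘ./ suc k)
      ≈⟨ ℚᵘ.*-inverseʳ (+ suc k ℚᵘ./ 1) ⟩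
    ℚᵘ.1ℚᵘ ∎)
    where open ℚᵘ.≃-Reasoning

recipℂ-inverse : ∀ k → .{{_ : NonZero k}} → (k Mℂ.× fromℚ 1ℚ) *ℂ recipℂ k ≈ℂ fromℚ 1ℚ
recipℂ-inverse (suc k) = termwise ((suc k Mℂ.× fromℚ 1ℚ) *ℂ recipℂ (suc k)) (fromℚ 1ℚ)
  (λ n → trans (cong₂ (λ a b → a ℚ.* r ℚ.+ ℚ.- (b ℚ.* 0ℚ)) (re-multiple (suc k) n) (im-multiple (suc k) n))
    (cong (ℚ._+ 0ℚ) (k*1/k k)))
  (λ n → trans (cong₂ (λ a b → a ℚ.* 0ℚ ℚ.+ b ℚ.* r) (re-multiple (suc k) n) (im-multiple (suc k) n))
    (cong₂ ℚ._+_ (ℚ.*-zeroʳ (+ suc k ℚ./ 1)) (ℚ.*-zeroˡ r)))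
  where
  r = + 1 ℚ./ suc k

convolve : ∀ {c ℓ} (R : RawRing c ℓ) (f g : ℕ → RawRing.Carrier R) → ℕ → RawRing.Carrier R
convolve R f g n = sum {suc n} (λ i → f (toℕ i) * g (n ∸ toℕ i))
  where
  open RawRing R
  open RawSemiringDefs rawSemiring using (sum)

record PositiveIntegersInvertible {c ℓ} (R : CommutativeRing c ℓ) : Set (c ⊔ ℓ) where
  open CommutativeRing R
  open RawSemiringDefs (Semiring.rawSemiring semiring) using () renaming (_×_ to _•_)
  field
    recip         : ∀ k → .{{NonZero k}} → Carrier
    recip-inverse : ∀ k → .{{_ : NonZero k}} → (k • 1#) * recip k ≈ 1#

-- Only the instance R = ℂ, opened at the end of the file, is of interest; the
-- definitions do not depend on how ℂ is constructed.
module FormalSeries {c ℓ} (R : CommutativeRing c ℓ) (inv : PositiveIntegersInvertible R) where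

  open CommutativeRing R using (Carrier; _≈_; 1#)
  open PositiveIntegersInvertible inv using (recip)

  private
    module R = CommutativeRing R
    module RP = RingProperties R.ring
    module MR = RawSemiringDefs (Semiring.rawSemiring R.semiring)
    rawR : RawRing c ℓ
    rawR = R.rawRing

  DegreeAtMost : ℕ → (ℕ → Carrier) → Set ℓ
  DegreeAtMost d p = ∀ j → d ℕ.< j → p j ≈ R.0#

  -- coeff p j is the coefficient of yʲ.
  record Poly : Set (c ⊔ ℓ) where
    constructor mkPoly
    field
      coeff  : ℕ → Carrier
      finite : ∃[ d ] DegreeAtMost d coeff

  open Poly public

  infix 4 _≈ₚ_

  _≈ₚ_ : Poly → Poly → Set ℓ
  p ≈ₚ q = ∀ j → coeff p j ≈ coeff q j

  private
    sum-zero : ∀ {n} (t : Fin n → Carrier) → (∀ i → t i ≈ R.0#) → MR.sum t ≈ R.0#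
    sum-zero {zero}  t z = R.refl
    sum-zero {suc n} t z =
      R.trans (R.+-cong (z fzero) (sum-zero (λ i → t (fsuc i)) (λ i → z (fsuc i)))) (R.+-identityˡ R.0#)

    •-zero : ∀ n {x} → x ≈ R.0# → n MR.× x ≈ R.0#
    •-zero zero    z = R.refl
    •-zero (suc n) z = R.trans (R.+-cong z (•-zero n z)) (R.+-identityˡ R.0#)

    degree-+ : ∀ {d f g} → DegreeAtMost d f → DegreeAtMost d g → DegreeAtMost d (λ j → f j R.+ g j)
    degree-+ p q j h = R.trans (R.+-cong (p j h) (q j h)) (R.+-identityˡ R.0#)

    degree-neg : ∀ {d f} → DegreeAtMost d f → DegreeAtMost d (λ j → R.- f j)
    degree-neg p j h = R.trans (R.-‿cong (p j h)) RP.-0#≈0#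

    degree-≤ : ∀ {d e f} → d ℕ.≤ e → DegreeAtMost d f → DegreeAtMost e f
    degree-≤ d≤e p j h = p j (ℕ.≤-<-trans d≤e h)

    degree-* : ∀ {d e f g} → DegreeAtMost d f → DegreeAtMost e g →
               DegreeAtMost (d ℕ.+ e) (convolve rawR f g)
    degree-* {d} {e} {f} {g} p q j h = sum-zero {suc j} (λ i → f (toℕ i) R.* g (j ∸ toℕ i)) λ i → term (toℕ i)
      where
      term : ∀ i → f i R.* g (j ∸ i) ≈ R.0#
      term i with d ℕ.<? i
      ... | yes d<i = R.trans (R.*-congʳ (p i d<i)) (R.zeroˡ _)
      ... | no  d≮i = R.trans (R.*-congˡ (q (j ∸ i) e<j∸i)) (R.zeroʳ _)
        where
        i≤d = ℕ.≮⇒≥ d≮i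
        e<j∸i : e ℕ.< j ∸ i
        e<j∸i = ℕ.m+n≤o⇒m≤o∸n (suc e)
          (ℕ.≤-trans (ℕ.+-monoʳ-≤ (suc e) i≤d) (subst (λ k → suc k ℕ.≤ j) (ℕ.+-comm d e) h))

    degree-′ : ∀ {d f} → DegreeAtMost d f → DegreeAtMost d (λ j → suc j MR.× f (suc j))
    degree-′ p j h = •-zero (suc j) (p (suc j) (ℕ.m<n⇒m<1+n h))

    degree-scale : ∀ {d f} a → DegreeAtMost d f → DegreeAtMost d (λ j → a R.* f j)
    degree-scale a p j h = R.trans (R.*-congˡ (p j h)) (R.zeroʳ a)

  infixl 6 _+ₚ_ _-ₚ_
  infixl 7 _*ₚ_ _·ₚ_
  infix  8 -ₚ_
  infixl 9 _′

  constₚ : Carrier → Poly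
  constₚ a = mkPoly (λ { zero → a ; (suc _) → R.0# }) (0 , λ { (suc _) _ → R.refl })

  0ₚ : Poly
  0ₚ = mkPoly (λ _ → R.0#) (0 , λ _ _ → R.refl)

  1ₚ : Poly
  1ₚ = constₚ 1#

  yₚ : Poly
  yₚ = mkPoly (λ { 1 → 1# ; _ → R.0# }) (1 , λ { (suc (suc _)) _ → R.refl ; (suc zero) (ℕ.s≤s ()) })

  _+ₚ_ : Poly → Poly → Poly
  mkPoly f (d , p) +ₚ mkPoly g (e , q) = mkPoly (λ j → f j R.+ g j)
    (d ℕ.⊔ e , degree-+ (degree-≤ (ℕ.m≤m⊔n d e) p) (degree-≤ (ℕ.m≤n⊔m d e) q))

  -ₚ_ : Poly → Poly
  -ₚ (mkPoly f (d , p)) = mkPoly (λ j → R.- f j) (d , degree-neg p)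

  _-ₚ_ : Poly → Poly → Poly
  p -ₚ q = p +ₚ (-ₚ q)

  _*ₚ_ : Poly → Poly → Poly
  mkPoly f (d , p) *ₚ mkPoly g (e , q) = mkPoly (convolve rawR f g) (d ℕ.+ e , degree-* p q)

  _·ₚ_ : Carrier → Poly → Poly
  a ·ₚ mkPoly f (d , p) = mkPoly (λ j → a R.* f j) (d , degree-scale a p)

  _′ : Poly → Poly
  mkPoly f (d , p) ′ = mkPoly (λ j → suc j MR.× f (suc j)) (d , degree-′ p)

  Poly-rawRing : RawRing (c ⊔ ℓ) ℓ
  Poly-rawRing = record
    { Carrier = Poly ; _≈_ = _≈ₚ_ ; _+_ = _+ₚ_ ; _*_ = _*ₚ_ ; -_ = -ₚ_ ; 0# = 0ₚ ; 1# = 1ₚ }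

  private
    module MP = RawSemiringDefs (RawRing.rawSemiring Poly-rawRing)

  infixr 8 _×ₚ_

  _×ₚ_ : ℕ → Poly → Poly
  _×ₚ_ = MP._×_

  sumₚ : ∀ {n} → (Fin n → Poly) → Poly
  sumₚ = MP.sum

  -- coefficient a n is the polynomial multiplying x⁻ⁿ.
  record A : Set (c ⊔ ℓ) where
    constructor mkA
    field
      coefficient : ℕ → Poly
      degree      : ∀ n → DegreeAtMost n (coeff (coefficient n))

  open A public

  infix 4 _≈ₐ_

  _≈ₐ_ : A → A → Set ℓ
  a ≈ₐ b = ∀ n → coefficient a n ≈ₚ coefficient b n

  private
    degree-0 : ∀ {d} → DegreeAtMost d (coeff 0ₚ)
    degree-0 _ _ = R.refl

    degree-×ₚ : ∀ {d p} n → DegreeAtMost d (coeff p) → DegreeAtMost d (coeff (n ×ₚ p))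
    degree-×ₚ zero    h = degree-0
    degree-×ₚ (suc n) h = degree-+ h (degree-×ₚ n h)

    degree-sumₚ : ∀ {d n} (t : Fin n → Poly) →
                  (∀ i → DegreeAtMost d (coeff (t i))) → DegreeAtMost d (coeff (sumₚ t))
    degree-sumₚ {n = zero}  t h = degree-0
    degree-sumₚ {n = suc n} t h = degree-+ (h fzero) (degree-sumₚ (λ i → t (fsuc i)) (λ i → h (fsuc i)))

  infixl 6 _+ₐ_ _-ₐ_
  infixl 7 _*ₐ_
  infix  8 -ₐ_

  0ₐ : A
  0ₐ = mkA (λ _ → 0ₚ) (λ _ → degree-0)

  1ₐ : A
  1ₐ = mkA (λ { zero → 1ₚ ; (suc _) → 0ₚ })
           (λ { zero → λ { (suc _) _ → R.refl } ; (suc _) → degree-0 })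

  x⁻¹ : A
  x⁻¹ = mkA (λ { 1 → 1ₚ ; _ → 0ₚ })
            (λ { zero → degree-0 ; 1 → λ { (suc _) _ → R.refl } ; (suc (suc _)) → degree-0 })

  y/x : A
  y/x = mkA (λ { 1 → yₚ ; _ → 0ₚ })
            (λ { zero → degree-0 ; 1 → proj₂ (finite yₚ) ; (suc (suc _)) → degree-0 })

  _+ₐ_ : A → A → A
  a +ₐ b = mkA (λ n → coefficient a n +ₚ coefficient b n) (λ n → degree-+ (degree a n) (degree b n))

  -ₐ_ : A → A
  -ₐ a = mkA (λ n → -ₚ coefficient a n) (λ n → degree-neg (degree a n))

  _-ₐ_ : A → A → A
  a -ₐ b = a +ₐ (-ₐ b)

  _*ₐ_ : A → A → A
  a *ₐ b = mkA (convolve Poly-rawRing (coefficient a) (coefficient b))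
    (λ n → degree-sumₚ {n = suc n} (λ i → coefficient a (toℕ i) *ₚ coefficient b (n ∸ toℕ i)) λ i →
      degree-≤ (ℕ.≤-reflexive (ℕ.m+[n∸m]≡n (Fin.toℕ≤pred[n] i)))
        (degree-* (degree a (toℕ i)) (degree b (n ∸ toℕ i))))

  A-rawRing : RawRing (c ⊔ ℓ) ℓ
  A-rawRing = record
    { Carrier = A ; _≈_ = _≈ₐ_ ; _+_ = _+ₐ_ ; _*_ = _*ₐ_ ; -_ = -ₐ_ ; 0# = 0ₐ ; 1# = 1ₐ }

  open RawSemiringDefs (RawRing.rawSemiring A-rawRing) public
    using () renaming (_^_ to _^ₐ_)

  -- a_x = -Σ_{n≥1} n qₙ(y) x⁻ⁿ⁻¹
  ∂x : A → A
  ∂x a = mkA (λ { zero → 0ₚ ; (suc n) → -ₚ (n ×ₚ coefficient a n) })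
    (λ { zero → degree-0
       ; (suc n) → degree-neg (degree-×ₚ n (degree-≤ (ℕ.n≤1+n n) (degree a n))) })

  ∂y : A → A
  ∂y a = mkA (λ n → coefficient a n ′) (λ n → degree-′ (degree a n))

  ZeroConstantTerm : A → Set ℓ
  ZeroConstantTerm u = coefficient u 0 ≈ₚ 0ₚ

  -- uᵏ has no terms x⁻ⁿ with n < k, so only k = 1, …, n contribute to the
  -- coefficient of x⁻ⁿ in Σ_{k≥1} (-1)ᵏ⁺¹ uᵏ / k.
  ^ₐ-vanishes : ∀ u → ZeroConstantTerm u → ∀ k n → n ℕ.< k → coefficient (u ^ₐ k) n ≈ₚ 0ₚ
  ^ₐ-vanishes u u₀ (suc k) n (ℕ.s≤s n≤k) = sumₚ-zero {suc n}
    (λ i → coefficient u (toℕ i) *ₚ coefficient (u ^ₐ k) (n ∸ toℕ i)) (λ i → term (toℕ i) (Fin.toℕ≤pred[n] i))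
    where
    sumₚ-zero : ∀ {m} (t : Fin m → Poly) → (∀ i → t i ≈ₚ 0ₚ) → sumₚ t ≈ₚ 0ₚ
    sumₚ-zero {zero}  t z j = R.refl
    sumₚ-zero {suc m} t z j =
      R.trans (R.+-cong (z fzero j) (sumₚ-zero (λ i → t (fsuc i)) (λ i → z (fsuc i)) j)) (R.+-identityˡ R.0#)

    term : ∀ i → i ℕ.≤ n → coefficient u i *ₚ coefficient (u ^ₐ k) (n ∸ i) ≈ₚ 0ₚ
    term zero    _   j = sum-zero {suc j}
      (λ i → coeff (coefficient u 0) (toℕ i) R.* coeff (coefficient (u ^ₐ k) n) (j ∸ toℕ i)) λ i → R.trans (R.*-congʳ (u₀ (toℕ i))) (R.zeroˡ _)
    term (suc i) i<n j = sum-zero {suc j}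
      (λ l → coeff (coefficient u (suc i)) (toℕ l) R.* coeff (coefficient (u ^ₐ k) (n ∸ suc i)) (j ∸ toℕ l)) λ l →
      R.trans (R.*-congˡ (^ₐ-vanishes u u₀ k (n ∸ suc i)
        (ℕ.<-≤-trans (ℕ.∸-monoʳ-< {n} {suc i} {0} ℕ.z<s i<n) n≤k) (j ∸ toℕ l))) (R.zeroʳ _)

  log1+ : (u : A) → ZeroConstantTerm u → A
  log1+ u _ = mkA
    (λ n → sumₚ {n} (λ i → term n (suc (toℕ i))))
    (λ n → degree-sumₚ {n = n} (λ i → term n (suc (toℕ i))) λ i → degree-scale _ (degree (u ^ₐ suc (toℕ i)) n))
    where
    term : ∀ n k → .{{NonZero k}} → Poly
    term n k = ((R.- 1#) MR.^ suc k R.* recip k) ·ₚ coefficient (u ^ₐ k) n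

  UnitConstantTerm : A → Set ℓ
  UnitConstantTerm a = coefficient a 0 ≈ₚ 1ₚ

  log : (a : A) → UnitConstantTerm a → A
  log a a₀ = log1+ (a -ₐ 1ₐ) λ j → R.trans (R.+-congʳ (a₀ j)) (R.-‿inverseʳ (coeff 1ₚ j))

  Equation : (V : A) → UnitConstantTerm V → Set ℓ
  Equation V V₀ =
    V ≈ₐ 1ₐ +ₐ y/x -ₐ x⁻¹ *ₐ V -ₐ ∂x V -ₐ x⁻¹ *ₐ ∂y V +ₐ x⁻¹ *ₐ log V V₀

  -- V = 1 + Σ_{n≥1} P_{n-1}(y) x⁻ⁿ
  P : A → ℕ → Poly
  P V n = coefficient V (suc n)

  -- log V = Σ_{n≥1} Q_n(y) x⁻ⁿ
  Q : (V : A) → UnitConstantTerm V → ℕ → Poly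
  Q V V₀ n = coefficient (log V V₀) n

ℂ-positiveIntegersInvertible : PositiveIntegersInvertible ℂ-commutativeRing
ℂ-positiveIntegersInvertible = record { recip = recipℂ ; recip-inverse = recipℂ-inverse }

open FormalSeries ℂ-commutativeRing ℂ-positiveIntegersInvertible public

{-# OPTIONS --safe #-}
module Submission where

-- Write s = 1/x, L = log V, δ = -x ∂/∂x (which multiplies the coefficient of x⁻ⁿ by n) and
-- D = s δ + (1 - s) ∂/∂y, a derivation.  Comparing coefficients, the two recurrences say
-- that W = D V - s V and U = D L - s vanish.  Since V · D L = D V, W = V U.  Applying D to the
-- equation of V and subtracting s times the equation gives the linear homogeneous equation
-- W + s W + s W_y = s δ W + s U, which expresses each coefficient of W through lower
-- coefficients of W and U.  As V has constant term 1, U and W vanish by induction.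

open import Defs using (convolve; PositiveIntegersInvertible; module FormalSeries)
open import Algebra.Bundles using (AbelianGroup; CommutativeRing; Semiring)
import Algebra.Consequences.Setoid as Consequences
import Algebra.Construct.Pointwise as Pointwise
import Algebra.Definitions.RawSemiring as RawSemiringDefs
import Algebra.Properties.CommutativeMonoid.Mult as CommutativeMonoidMult
import Algebra.Properties.Monoid.Sum as MonoidSum
import Algebra.Properties.AbelianGroup as AbelianGroupProperties
import Algebra.Properties.Group as GroupProperties
import Algebra.Properties.Ring as RingProperties
import Algebra.Properties.Semiring.Mult as SemiringMult
import Algebra.Solver.Ring.NaturalCoefficients.Default as SemiringSolver
open import Data.Fin.Base using (Fin; toℕ) renaming (zero to fzero; suc to fsuc)
open import Data.Nat.Base using (ℕ; zero; suc; _≤_; _<_; _∸_; z≤n; s≤s)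
open import Data.Nat.Induction using (<-rec)
import Data.Nat.Properties as ℕ
open import Data.Product.Base using (_×_; _,_)
open import Function.Base using (_∘_)
open import Level using (_⊔_)

-- Derivations of a commutative ring, and the derivative of a truncated logarithm.

record IsDerivation {c ℓ} (R : CommutativeRing c ℓ)
                    (d : CommutativeRing.Carrier R → CommutativeRing.Carrier R) : Set (c ⊔ ℓ) where
  open CommutativeRing R
  field
    cong    : ∀ {x y} → x ≈ y → d x ≈ d y
    +-homo  : ∀ x y → d (x + y) ≈ d x + d y
    leibniz : ∀ x y → d (x * y) ≈ d x * y + x * d y

module DerivationProperties {c ℓ} (R : CommutativeRing c ℓ)
                            {d : CommutativeRing.Carrier R → CommutativeRing.Carrier R}
                            (isDerivation : IsDerivation R d) where

  open CommutativeRing R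
  open IsDerivation isDerivation
  open RawSemiringDefs (Semiring.rawSemiring semiring) using (sum; _^_)
  open SemiringMult semiring renaming (_×_ to _•_)
  open RingProperties ring using (+-identityʳ-unique)
  open SemiringSolver commutativeSemiring using (solve; _:=_; _:+_; _:*_; con)
  open import Relation.Binary.Reasoning.Setoid setoid

  d0≈0 : d 0# ≈ 0#
  d0≈0 = begin
    d 0#                  ≈⟨ cong (zeroˡ 0#) ⟨
    d (0# * 0#)           ≈⟨ leibniz 0# 0# ⟩
    d 0# * 0# + 0# * d 0# ≈⟨ solve 1 (λ a → a :* con 0 :+ con 0 :* a := con 0) refl (d 0#) ⟩
    0#                    ∎

  d1≈0 : d 1# ≈ 0#
  d1≈0 = +-identityʳ-unique (d 1#) (d 1#) (begin
    d 1# + d 1#           ≈⟨ solve 1 (λ a → a :+ a := a :* con 1 :+ con 1 :* a) refl (d 1#) ⟩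
    d 1# * 1# + 1# * d 1# ≈⟨ leibniz 1# 1# ⟨
    d (1# * 1#)           ≈⟨ cong (*-identityˡ 1#) ⟩
    d 1#                  ∎)

  d-• : ∀ n x → d (n • x) ≈ n • d x
  d-• zero    x = d0≈0
  d-• (suc n) x = trans (+-homo x (n • x)) (+-congˡ (d-• n x))

  d-^ : ∀ u k → d (u ^ suc k) ≈ suc k • (u ^ k * d u)
  d-^ u zero = begin
    d (u * 1#)          ≈⟨ leibniz u 1# ⟩
    d u * 1# + u * d 1# ≈⟨ +-congˡ (*-congˡ d1≈0) ⟩
    d u * 1# + u * 0#   ≈⟨ solve 2 (λ a b → a :* con 1 :+ b :* con 0 := con 1 :* a :+ con 0) refl (d u) u ⟩
    1# * d u + 0#       ∎
  d-^ u (suc k) = begin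
    d (u * u ^ suc k)
      ≈⟨ leibniz u (u ^ suc k) ⟩
    d u * u ^ suc k + u * d (u ^ suc k)
      ≈⟨ +-cong (*-comm _ _) (*-congˡ (d-^ u k)) ⟩
    u ^ suc k * d u + u * (suc k • (u ^ k * d u))
      ≈⟨ +-congˡ (×-comm-* (suc k) u (u ^ k * d u)) ⟩
    u ^ suc k * d u + suc k • (u * (u ^ k * d u))
      ≈⟨ +-congˡ (×-congʳ (suc k) (*-assoc u (u ^ k) (d u))) ⟨
    u ^ suc k * d u + suc k • (u ^ suc k * d u) ∎

  -- Each `v * d (t i)` is the difference of `r i` and `r (suc i)`, so the sum collapses.
  -- Differences are written as sums throughout, because the solver works over semirings.
  telescope : ∀ v (t r : ℕ → Carrier) → (∀ i → v * d (t i) + r (suc i) ≈ r i) →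
              ∀ N → v * d (sum {N} (t ∘ toℕ)) + r N ≈ r 0
  telescope v t r step zero = trans (+-congʳ (trans (*-congˡ d0≈0) (zeroʳ v))) (+-identityˡ (r 0))
  telescope v t r step (suc N) = begin
    v * d (t 0 + S) + r (suc N)
      ≈⟨ +-congʳ (*-congˡ (+-homo (t 0) S)) ⟩
    v * (d (t 0) + d S) + r (suc N)
      ≈⟨ solve 4 (λ v a b c → v :* (a :+ b) :+ c := v :* a :+ (v :* b :+ c)) refl v (d (t 0)) (d S) (r (suc N)) ⟩
    v * d (t 0) + (v * d S + r (suc N))
      ≈⟨ +-congˡ (telescope v (t ∘ suc) (r ∘ suc) (step ∘ suc) N) ⟩
    v * d (t 0) + r 1
      ≈⟨ step 0 ⟩
    r 0 ∎
    where S = sum {N} (t ∘ suc ∘ toℕ)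

  -- Here `e k` plays the role of (-1)ᵏ/(k+1) and `ε k` that of (-1)ᵏ. Differentiating the terms
  -- leaves the alternating geometric sum of the `u ^ i * d u`, which telescopes against `1# + u` up
  -- to a remainder in `u ^ N`.
  truncatedLog-derivative : ∀ (e ε : ℕ → Carrier) → (∀ k → suc k • e k ≈ ε k) → ε 0 ≈ 1# →
    (∀ k → ε k + ε (suc k) ≈ 0#) → (∀ k → d (e k) ≈ 0#) → ∀ u N →
    (1# + u) * d (sum {N} (λ i → e (toℕ i) * u ^ suc (toℕ i))) + ε N * (u ^ N * d u) ≈ d u
  truncatedLog-derivative e ε e-ε ε₀ ε-alternates de u N = begin
    (1# + u) * d (sum {N} (t ∘ toℕ)) + r N ≈⟨ telescope (1# + u) t r step N ⟩
    ε 0 * (1# * d u)                       ≈⟨ *-cong ε₀ (*-identityˡ (d u)) ⟩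
    1# * d u                               ≈⟨ *-identityˡ (d u) ⟩
    d u                                    ∎
    where
    t r : ℕ → Carrier
    t i = e i * u ^ suc i
    r i = ε i * (u ^ i * d u)

    dt : ∀ i → d (t i) ≈ r i
    dt i = begin
      d (e i * u ^ suc i)
        ≈⟨ leibniz (e i) (u ^ suc i) ⟩
      d (e i) * u ^ suc i + e i * d (u ^ suc i)
        ≈⟨ +-cong (trans (*-congʳ (de i)) (zeroˡ _)) (*-congˡ (d-^ u i)) ⟩
      0# + e i * (suc i • (u ^ i * d u))
        ≈⟨ +-identityˡ _ ⟩
      e i * (suc i • (u ^ i * d u))
        ≈⟨ ×-comm-* (suc i) (e i) (u ^ i * d u) ⟩
      suc i • (e i * (u ^ i * d u))
        ≈⟨ ×-assoc-* (suc i) (e i) (u ^ i * d u) ⟨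
      (suc i • e i) * (u ^ i * d u)
        ≈⟨ *-congʳ (e-ε i) ⟩
      r i ∎

    step : ∀ i → (1# + u) * d (t i) + r (suc i) ≈ r i
    step i = begin
      (1# + u) * d (t i) + r (suc i)
        ≈⟨ +-congʳ (*-congˡ (dt i)) ⟩
      (1# + u) * r i + r (suc i)
        ≈⟨ solve 5 (λ u a b p q → (con 1 :+ u) :* (a :* (p :* q)) :+ b :* (u :* p :* q)
             := a :* (p :* q) :+ (a :+ b) :* (u :* p :* q)) refl u (ε i) (ε (suc i)) (u ^ i) (d u) ⟩
      r i + (ε i + ε (suc i)) * (u ^ suc i * d u)
        ≈⟨ +-congˡ (trans (*-congʳ (ε-alternates i)) (zeroˡ _)) ⟩
      r i + 0#
        ≈⟨ +-identityʳ (r i) ⟩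
      r i ∎

-- The ring of formal power series and its derivations.

module PowerSeries {c ℓ} (R : CommutativeRing c ℓ) where

  open CommutativeRing R
  open SemiringMult semiring renaming (_×_ to _•_)
  open CommutativeMonoidMult +-commutativeMonoid using () renaming (×-distrib-+ to •-distrib-+)
  open SemiringSolver commutativeSemiring using (solve; _:=_; _:+_; _:*_; con)
  open import Relation.Binary.Reasoning.Setoid setoid

  Series : Set c
  Series = ℕ → Carrier

  private
    module Additive = AbelianGroup (Pointwise.abelianGroup ℕ +-abelianGroup)

  open Additive public using () renaming (_≈_ to infix 4 _≋_; _∙_ to infixl 6 _⊕_; ε to 𝟘)

  infixl 7 _⊛_

  _⊛_ : Series → Series → Series
  _⊛_ = convolve rawRing

  constant : Carrier → Series
  constant a zero    = a
  constant a (suc _) = 0#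

  tail : Series → Series
  tail f n = f (suc n)

  -- A product coefficient sees only coefficients of index at most its own. This allows a series to
  -- be replaced by a truncation and drives the vanishing arguments.
  ⊛-cong-≤ : ∀ {f f′ g g′} n → (∀ i → i ≤ n → f i ≈ f′ i) → (∀ i → i ≤ n → g i ≈ g′ i) →
             (f ⊛ g) n ≈ (f′ ⊛ g′) n
  ⊛-cong-≤ zero    p q = +-congʳ (*-cong (p 0 z≤n) (q 0 z≤n))
  ⊛-cong-≤ (suc n) p q = +-cong (*-cong (p 0 z≤n) (q (suc n) ℕ.≤-refl))
    (⊛-cong-≤ n (λ i i≤n → p (suc i) (s≤s i≤n)) (λ i i≤n → q i (ℕ.m≤n⇒m≤1+n i≤n)))

  ⊛-cong : ∀ {f f′ g g′} → f ≋ f′ → g ≋ g′ → f ⊛ g ≋ f′ ⊛ g′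
  ⊛-cong p q n = ⊛-cong-≤ n (λ i _ → p i) (λ i _ → q i)

  ⊛-distribʳ : ∀ h f g → (f ⊕ g) ⊛ h ≋ f ⊛ h ⊕ g ⊛ h
  ⊛-distribʳ h f g zero = solve 3 (λ a b c → (a :+ b) :* c :+ con 0
    := (a :* c :+ con 0) :+ (b :* c :+ con 0)) refl (f 0) (g 0) (h 0)
  ⊛-distribʳ h f g (suc n) = trans (+-congˡ (⊛-distribʳ h (tail f) (tail g) n))
    (solve 5 (λ a b c x y → (a :+ b) :* c :+ (x :+ y) := (a :* c :+ x) :+ (b :* c :+ y)) refl
      (f 0) (g 0) (h (suc n)) ((tail f ⊛ h) n) ((tail g ⊛ h) n))

  scale-⊛ : ∀ a f g n → ((λ i → a * f i) ⊛ g) n ≈ a * (f ⊛ g) n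
  scale-⊛ a f g zero = solve 3 (λ a b c → a :* b :* c :+ con 0 := a :* (b :* c :+ con 0)) refl
    a (f 0) (g 0)
  scale-⊛ a f g (suc n) = trans (+-congˡ (scale-⊛ a (tail f) g n))
    (solve 4 (λ a b c x → a :* b :* c :+ a :* x := a :* (b :* c :+ x)) refl
      a (f 0) (g (suc n)) ((tail f ⊛ g) n))

  ⊛-assoc : ∀ f g h → (f ⊛ g) ⊛ h ≋ f ⊛ (g ⊛ h)
  ⊛-assoc f g h zero = solve 3 (λ a b c → (a :* b :+ con 0) :* c :+ con 0
    := a :* (b :* c :+ con 0) :+ con 0) refl (f 0) (g 0) (h 0)
  ⊛-assoc f g h (suc n) = begin
    (f 0 * g 0 + 0#) * h (suc n) + (tail (f ⊛ g) ⊛ h) n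
      -- By computation, `tail (f ⊛ g)` is `f 0` times `tail g` plus `tail f ⊛ g`.
      ≈⟨ +-congˡ (⊛-distribʳ h (λ i → f 0 * tail g i) (tail f ⊛ g) n) ⟩
    (f 0 * g 0 + 0#) * h (suc n) + (((λ i → f 0 * tail g i) ⊛ h) n + ((tail f ⊛ g) ⊛ h) n)
      ≈⟨ +-congˡ (+-cong (scale-⊛ (f 0) (tail g) h n) (⊛-assoc (tail f) g h n)) ⟩
    (f 0 * g 0 + 0#) * h (suc n) + (f 0 * (tail g ⊛ h) n + (tail f ⊛ (g ⊛ h)) n)
      ≈⟨ solve 5 (λ a b c x y → (a :* b :+ con 0) :* c :+ (a :* x :+ y) := a :* (b :* c :+ x) :+ y) refl
           (f 0) (g 0) (h (suc n)) ((tail g ⊛ h) n) ((tail f ⊛ (g ⊛ h)) n) ⟩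
    f 0 * (g ⊛ h) (suc n) + (tail f ⊛ (g ⊛ h)) n ∎

  -- The convolution unfolds by definition at the constant term of the left factor. Peeling off the
  -- other end as well is what makes commutativity an easy induction.
  ⊛-suc : ∀ f g n → (f ⊛ g) (suc n) ≈ f (suc n) * g 0 + (f ⊛ tail g) n
  ⊛-suc f g zero = solve 4 (λ a b c d → a :* d :+ (b :* c :+ con 0) := b :* c :+ (a :* d :+ con 0)) refl
    (f 0) (f 1) (g 0) (g 1)
  ⊛-suc f g (suc n) = trans (+-congˡ (⊛-suc (tail f) g n))
    (solve 3 (λ a b c → a :+ (b :+ c) := b :+ (a :+ c)) refl
      (f 0 * g (suc (suc n))) (f (suc (suc n)) * g 0) ((tail f ⊛ tail g) n))

  ⊛-comm : ∀ f g → f ⊛ g ≋ g ⊛ f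
  ⊛-comm f g zero    = +-congʳ (*-comm (f 0) (g 0))
  ⊛-comm f g (suc n) = trans (+-cong (*-comm (f 0) (g (suc n))) (⊛-comm (tail f) g n))
    (sym (⊛-suc g f n))

  𝟘-⊛ : ∀ f → 𝟘 ⊛ f ≋ 𝟘
  𝟘-⊛ f zero    = trans (+-identityʳ _) (zeroˡ (f 0))
  𝟘-⊛ f (suc n) = trans (+-cong (zeroˡ (f (suc n))) (𝟘-⊛ f n)) (+-identityˡ 0#)

  constant-⊛ : ∀ a f n → (constant a ⊛ f) n ≈ a * f n
  constant-⊛ a f zero    = +-identityʳ (a * f 0)
  constant-⊛ a f (suc n) = trans (+-congˡ (𝟘-⊛ f n)) (+-identityʳ (a * f (suc n)))

  commutativeRing : CommutativeRing c ℓ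
  commutativeRing = record
    { _*_ = _⊛_
    ; 1#  = constant 1#
    ; isCommutativeRing = record
      { isRing = record
        { +-isAbelianGroup = Additive.isAbelianGroup
        ; *-cong           = ⊛-cong
        ; *-assoc          = ⊛-assoc
        ; *-identity       = comm∧idˡ⇒id ⊛-comm λ f n → trans (constant-⊛ 1# f n) (*-identityˡ (f n))
        ; distrib          = comm∧distrʳ⇒distr Additive.∙-cong ⊛-comm ⊛-distribʳ
        }
      ; *-comm = ⊛-comm
      }
    }
    where open Consequences Additive.setoid using (comm∧idˡ⇒id; comm∧distrʳ⇒distr)

  •-zeroʳ : ∀ n → n • 0# ≈ 0#
  •-zeroʳ zero    = refl
  •-zeroʳ (suc n) = trans (+-identityˡ _) (•-zeroʳ n)

  -- The operator t d/dt in the series variable t. For t = 1/x it is -x ∂/∂x.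
  euler : Series → Series
  euler f n = n • f n

  derivative : Series → Series
  derivative f = tail (euler f)

  euler-⊛ : ∀ f g → euler (f ⊛ g) ≋ euler f ⊛ g ⊕ f ⊛ euler g
  euler-⊛ f g zero = solve 2 (λ a b → con 0 := (con 0 :* b :+ con 0) :+ (a :* con 0 :+ con 0)) refl
    (f 0) (g 0)
  euler-⊛ f g (suc n) = begin
    suc n • (f 0 * g (suc n) + X)
      ≈⟨ •-distrib-+ (f 0 * g (suc n)) X (suc n) ⟩
    suc n • (f 0 * g (suc n)) + (X + n • X)
      ≈⟨ +-cong (sym (×-comm-* (suc n) (f 0) (g (suc n)))) (+-congˡ (euler-⊛ (tail f) g n)) ⟩
    a + (X + (Y + Z))
      ≈⟨ solve 5 (λ a b x y z → a :+ (x :+ (y :+ z)) := (con 0 :* b :+ (x :+ y)) :+ (a :+ z)) refl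
           a (g (suc n)) X Y Z ⟩
    (0# * g (suc n) + (X + Y)) + (a + Z)
      -- By computation, `euler f` has constant term `0#` and tail `tail f ⊕ euler (tail f)`.
      ≈⟨ +-congʳ (+-congˡ (⊛-distribʳ g (tail f) (euler (tail f)) n)) ⟨
    (euler f ⊛ g ⊕ f ⊛ euler g) (suc n) ∎
    where
    a = f 0 * (suc n • g (suc n))
    X = (tail f ⊛ g) n
    Y = (euler (tail f) ⊛ g) n
    Z = (tail f ⊛ euler g) n

  euler-isDerivation : IsDerivation commutativeRing euler
  euler-isDerivation = record
    { cong    = λ f≋g n → ×-congʳ n (f≋g n)
    ; +-homo  = λ f g n → •-distrib-+ (f n) (g n) n
    ; leibniz = euler-⊛
    }

  derivative-isDerivation : IsDerivation commutativeRing derivative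
  derivative-isDerivation = record
    { cong    = λ f≋g n → ×-congʳ (suc n) (f≋g (suc n))
    ; +-homo  = λ f g n → •-distrib-+ (f (suc n)) (g (suc n)) (suc n)
    ; leibniz = λ f g n → begin
        euler (f ⊛ g) (suc n)
          ≈⟨ euler-⊛ f g (suc n) ⟩
        (euler f ⊛ g) (suc n) + (f ⊛ euler g) (suc n)
          -- The index shift in `derivative` is harmless because `euler` kills constant terms: the
          -- first product is peeled at its left factor, the second at its right factor.
          ≈⟨ +-congˡ (⊛-suc f (euler g) n) ⟩
        (0# * g (suc n) + (derivative f ⊛ g) n) + (f (suc n) * 0# + (f ⊛ derivative g) n)
          ≈⟨ solve 4 (λ a b x y → (con 0 :* b :+ x) :+ (a :* con 0 :+ y) := x :+ y) refl
               (f (suc n)) (g (suc n)) ((derivative f ⊛ g) n) ((f ⊛ derivative g) n) ⟩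
        (derivative f ⊛ g) n + (f ⊛ derivative g) n ∎
    }

  euler-constant : ∀ a → euler (constant a) ≋ 𝟘
  euler-constant a zero    = refl
  euler-constant a (suc n) = •-zeroʳ (suc n)

  derivative-constant : ∀ a → derivative (constant a) ≋ 𝟘
  derivative-constant a n = •-zeroʳ (suc n)

  coefficientwise : (Carrier → Carrier) → Series → Series
  coefficientwise d f n = d (f n)

  module _ {d} (isDerivation : IsDerivation R d) where
    private
      module d = IsDerivation isDerivation

    coefficientwise-⊛ : ∀ f g → coefficientwise d (f ⊛ g) ≋ coefficientwise d f ⊛ g ⊕ f ⊛ coefficientwise d g
    coefficientwise-⊛ f g zero = begin
      d (f 0 * g 0 + 0#)
        ≈⟨ d.cong (+-identityʳ _) ⟩
      d (f 0 * g 0)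
        ≈⟨ d.leibniz (f 0) (g 0) ⟩
      d (f 0) * g 0 + f 0 * d (g 0)
        ≈⟨ solve 2 (λ a b → a :+ b := (a :+ con 0) :+ (b :+ con 0)) refl _ _ ⟩
      (d (f 0) * g 0 + 0#) + (f 0 * d (g 0) + 0#) ∎
    coefficientwise-⊛ f g (suc n) = begin
      d (f 0 * g (suc n) + (tail f ⊛ g) n)
        ≈⟨ d.+-homo _ _ ⟩
      d (f 0 * g (suc n)) + d ((tail f ⊛ g) n)
        ≈⟨ +-cong (d.leibniz _ _) (coefficientwise-⊛ (tail f) g n) ⟩
      (a + b) + (x + y)
        ≈⟨ solve 4 (λ a b x y → (a :+ b) :+ (x :+ y) := (a :+ x) :+ (b :+ y)) refl a b x y ⟩
      (a + x) + (b + y) ∎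
      where
      a = d (f 0) * g (suc n)
      b = f 0 * d (g (suc n))
      x = (coefficientwise d (tail f) ⊛ g) n
      y = (tail f ⊛ coefficientwise d g) n

    coefficientwise-constant : ∀ {a} → d a ≈ 0# → coefficientwise d (constant a) ≋ 𝟘
    coefficientwise-constant da≈0 zero    = da≈0
    coefficientwise-constant da≈0 (suc n) = DerivationProperties.d0≈0 R isDerivation

    coefficientwise-isDerivation : IsDerivation commutativeRing (coefficientwise d)
    coefficientwise-isDerivation = record
      { cong    = λ f≋g n → d.cong (f≋g n)
      ; +-homo  = λ f g n → d.+-homo (f n) (g n)
      ; leibniz = coefficientwise-⊛
      }

-- The functional equation in a ring with two commuting derivations.

module FunctionalEquation {c ℓ} (B : CommutativeRing c ℓ) where

  open CommutativeRing B

  -- s and z stand for 1/x and y/x, δ and ∂ for -x ∂/∂x and ∂/∂y, and L for log V.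
  module Solution
    {δ ∂ : Carrier → Carrier} (δ-isDerivation : IsDerivation B δ) (∂-isDerivation : IsDerivation B ∂)
    (δ∂≈∂δ : ∀ f → δ (∂ f) ≈ ∂ (δ f))
    {s z V L : Carrier} (δs≈s : δ s ≈ s) (∂s≈0 : ∂ s ≈ 0#) (δz≈z : δ z ≈ z) (∂z≈s : ∂ z ≈ s)
    (V∂L≈∂V : V * ∂ L ≈ ∂ V) (VδL≈δV : V * δ L ≈ δ V)
    (equation : V + s * V + s * ∂ V ≈ 1# + z + s * δ V + s * L)
    where

    open RingProperties ring using (+-cancelʳ)
    open SemiringSolver commutativeSemiring using (solve; _:=_; _:+_; _:*_; con)
    open import Relation.Binary.Reasoning.Setoid setoid

    private
      module δ = IsDerivation δ-isDerivation
      module ∂ = IsDerivation ∂-isDerivation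

      δ1≈0 = DerivationProperties.d1≈0 B δ-isDerivation
      ∂1≈0 = DerivationProperties.d1≈0 B ∂-isDerivation

    -- `U` is D L - s with D = s δ + (1 - s) ∂. Defining `W` as a multiple of `U` makes its
    -- vanishing follow from that of `U`; `W-relation` recovers W = D V - s V.
    U W : Carrier
    U = (s * δ L + ∂ L) - (s * ∂ L + s)
    W = V * U

    U-relation : U + (s * ∂ L + s) ≈ s * δ L + ∂ L
    U-relation = trans (+-assoc _ _ _) (trans (+-congˡ (-‿inverseˡ _)) (+-identityʳ _))

    W-relation : W + (s * ∂ V + s * V) ≈ s * δ V + ∂ V
    W-relation = begin
      V * U + (s * ∂ V + s * V)
        ≈⟨ +-congˡ (+-congʳ (*-congˡ V∂L≈∂V)) ⟨
      V * U + (s * (V * ∂ L) + s * V)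
        ≈⟨ solve 4 (λ v u s l → v :* u :+ (s :* (v :* l) :+ s :* v) := v :* (u :+ (s :* l :+ s))) refl V U s (∂ L) ⟩
      V * (U + (s * ∂ L + s))
        ≈⟨ *-congˡ U-relation ⟩
      V * (s * δ L + ∂ L)
        ≈⟨ solve 4 (λ v s k l → v :* (s :* k :+ l) := s :* (v :* k) :+ v :* l) refl V s (δ L) (∂ L) ⟩
      s * (V * δ L) + V * ∂ L
        ≈⟨ +-cong (*-congˡ VδL≈δV) V∂L≈∂V ⟩
      s * δ V + ∂ V ∎

    private
      δ-s* : ∀ f → δ (s * f) ≈ s * (f + δ f)
      δ-s* f = trans (δ.leibniz s f) (trans (+-congʳ (*-congʳ δs≈s)) (sym (distribˡ s f (δ f))))

      ∂-s* : ∀ f → ∂ (s * f) ≈ s * ∂ f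
      ∂-s* f = trans (∂.leibniz s f) (trans (+-congʳ (trans (*-congʳ ∂s≈0) (zeroˡ f))) (+-identityˡ _))

      δW-relation : δ W + (s * (∂ V + δ (∂ V)) + s * (V + δ V)) ≈ s * (δ V + δ (δ V)) + δ (∂ V)
      δW-relation = begin
        δ W + (s * (∂ V + δ (∂ V)) + s * (V + δ V)) ≈⟨ +-congˡ (+-cong (δ-s* (∂ V)) (δ-s* V)) ⟨
        δ W + (δ (s * ∂ V) + δ (s * V))             ≈⟨ +-congˡ (δ.+-homo _ _) ⟨
        δ W + δ (s * ∂ V + s * V)                   ≈⟨ δ.+-homo _ _ ⟨
        δ (W + (s * ∂ V + s * V))                   ≈⟨ δ.cong W-relation ⟩
        δ (s * δ V + ∂ V)                           ≈⟨ δ.+-homo _ _ ⟩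
        δ (s * δ V) + δ (∂ V)                       ≈⟨ +-congʳ (δ-s* (δ V)) ⟩
        s * (δ V + δ (δ V)) + δ (∂ V)               ∎

      ∂W-relation : ∂ W + (s * ∂ (∂ V) + s * ∂ V) ≈ s * δ (∂ V) + ∂ (∂ V)
      ∂W-relation = begin
        ∂ W + (s * ∂ (∂ V) + s * ∂ V)   ≈⟨ +-congˡ (+-cong (∂-s* (∂ V)) (∂-s* V)) ⟨
        ∂ W + (∂ (s * ∂ V) + ∂ (s * V)) ≈⟨ +-congˡ (∂.+-homo _ _) ⟨
        ∂ W + ∂ (s * ∂ V + s * V)       ≈⟨ ∂.+-homo _ _ ⟨
        ∂ (W + (s * ∂ V + s * V))       ≈⟨ ∂.cong W-relation ⟩
        ∂ (s * δ V + ∂ V)               ≈⟨ ∂.+-homo _ _ ⟩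
        ∂ (s * δ V) + ∂ (∂ V)           ≈⟨ +-congʳ (trans (∂-s* (δ V)) (*-congˡ (sym (δ∂≈∂δ V)))) ⟩
        s * δ (∂ V) + ∂ (∂ V)           ∎

      δ-equation : δ V + s * (V + δ V) + s * (∂ V + δ (∂ V)) ≈ z + s * (δ V + δ (δ V)) + s * (L + δ L)
      δ-equation = begin
        δ V + s * (V + δ V) + s * (∂ V + δ (∂ V))
          ≈⟨ +-cong (+-congˡ (δ-s* V)) (δ-s* (∂ V)) ⟨
        δ V + δ (s * V) + δ (s * ∂ V)
          ≈⟨ trans (δ.+-homo _ _) (+-congʳ (δ.+-homo _ _)) ⟨
        δ (V + s * V + s * ∂ V)
          ≈⟨ δ.cong equation ⟩
        δ (1# + z + s * δ V + s * L)
          ≈⟨ trans (δ.+-homo _ _) (+-congʳ (trans (δ.+-homo _ _) (+-congʳ (δ.+-homo _ _)))) ⟩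
        δ 1# + δ z + δ (s * δ V) + δ (s * L)
          ≈⟨ +-cong (+-cong (trans (+-cong δ1≈0 δz≈z) (+-identityˡ z)) (δ-s* (δ V))) (δ-s* L) ⟩
        z + s * (δ V + δ (δ V)) + s * (L + δ L) ∎

      ∂-equation : ∂ V + s * ∂ V + s * ∂ (∂ V) ≈ s + s * δ (∂ V) + s * ∂ L
      ∂-equation = begin
        ∂ V + s * ∂ V + s * ∂ (∂ V)
          ≈⟨ +-cong (+-congˡ (∂-s* V)) (∂-s* (∂ V)) ⟨
        ∂ V + ∂ (s * V) + ∂ (s * ∂ V)
          ≈⟨ trans (∂.+-homo _ _) (+-congʳ (∂.+-homo _ _)) ⟨
        ∂ (V + s * V + s * ∂ V)
          ≈⟨ ∂.cong equation ⟩
        ∂ (1# + z + s * δ V + s * L)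
          ≈⟨ trans (∂.+-homo _ _) (+-congʳ (trans (∂.+-homo _ _) (+-congʳ (∂.+-homo _ _)))) ⟩
        ∂ 1# + ∂ z + ∂ (s * δ V) + ∂ (s * L)
          ≈⟨ +-cong (+-cong (trans (+-cong ∂1≈0 ∂z≈s) (+-identityˡ s))
               (trans (∂-s* (δ V)) (*-congˡ (sym (δ∂≈∂δ V))))) (∂-s* L) ⟩
        s + s * δ (∂ V) + s * ∂ L ∎

    -- D(equation) - s · equation for D = s δ + (1 - s) ∂, with every term moved to the side where it is positive.
    W-equation : W + s * W + s * ∂ W ≈ s * δ W + s * U
    W-equation = cancel-relation
      -- The first four relations, weighted by the coefficients of `U`, `W`, `δ W`, `∂ W` in the
      -- goal, eliminate these elements. The other four form the combination of the equation and its
      -- derivatives. `sym` stands for a negative weight.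
      (+-cong (+-cong (+-cong (+-cong (+-cong (+-cong
        (*-congˡ U-relation) (*-congˡ (sym W-relation))) (*-congˡ δW-relation)) (*-congˡ (sym ∂W-relation)))
        (*-congˡ equation)) (*-congˡ (sym δ-equation))) (+-cong (sym ∂-equation) (*-congˡ ∂-equation)))
      (solve 15 (λ s z V δV ∂V δδV δ∂V ∂∂V L δL ∂L U W δW ∂W →
         (W :+ s :* W :+ s :* ∂W) :+
           (s :* (U :+ (s :* ∂L :+ s)) :+ (con 1 :+ s) :* (s :* δV :+ ∂V)
           :+ s :* (δW :+ (s :* (∂V :+ δ∂V) :+ s :* (V :+ δV))) :+ s :* (s :* δ∂V :+ ∂∂V)
           :+ s :* (V :+ s :* V :+ s :* ∂V) :+ s :* (z :+ s :* (δV :+ δδV) :+ s :* (L :+ δL))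
           :+ ((s :+ s :* δ∂V :+ s :* ∂L) :+ s :* (∂V :+ s :* ∂V :+ s :* ∂∂V)))
         := (s :* δW :+ s :* U) :+
           (s :* (s :* δL :+ ∂L) :+ (con 1 :+ s) :* (W :+ (s :* ∂V :+ s :* V))
           :+ s :* (s :* (δV :+ δδV) :+ δ∂V) :+ s :* (∂W :+ (s :* ∂∂V :+ s :* ∂V))
           :+ s :* (con 1 :+ z :+ s :* δV :+ s :* L) :+ s :* (δV :+ s :* (V :+ δV) :+ s :* (∂V :+ δ∂V))
           :+ ((∂V :+ s :* ∂V :+ s :* ∂∂V) :+ s :* (s :+ s :* δ∂V :+ s :* ∂L))))
         refl s z V (δ V) (∂ V) (δ (δ V)) (δ (∂ V)) (∂ (∂ V)) L (δ L) (∂ L) U W (δ W) (∂ W))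
      where
      cancel-relation : ∀ {a b c d} → c ≈ d → a + c ≈ b + d → a ≈ b
      cancel-relation c≈d a+c≈b+d = +-cancelʳ _ _ _ (trans (+-congˡ (sym c≈d)) a+c≈b+d)

-- Orders of vanishing and the logarithm of a power series.

module SeriesLogarithm {c ℓ} (S : CommutativeRing c ℓ) where

  open CommutativeRing S
  open PowerSeries S
  open SemiringMult semiring using () renaming (_×_ to _•_)
  open RawSemiringDefs (Semiring.rawSemiring semiring) using (sum)
  open import Relation.Binary.Reasoning.Setoid setoid

  private
    module B  = CommutativeRing commutativeRing
    module BM = SemiringMult B.semiring
    module BR = RawSemiringDefs (Semiring.rawSemiring B.semiring)

  infixr 8 _^_

  _^_ : Series → ℕ → Series
  _^_ = BR._^_

  sum-coefficient : ∀ {m} (t : Fin m → Series) n → BR.sum t n ≈ sum (λ i → t i n)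
  sum-coefficient {zero}  t n = refl
  sum-coefficient {suc m} t n = +-congˡ (sum-coefficient (t ∘ fsuc) n)

  multiple-coefficient : ∀ m f n → (m BM.× f) n ≈ m • f n
  multiple-coefficient zero    f n = refl
  multiple-coefficient (suc m) f n = +-congˡ (multiple-coefficient m f n)

  sum-extend : ∀ (t : ℕ → Carrier) {m N} → m ≤ N → (∀ i → m ≤ i → t i ≈ 0#) →
               sum {m} (t ∘ toℕ) ≈ sum {N} (t ∘ toℕ)
  sum-extend t {N = zero}  z≤n       t≈0 = refl
  sum-extend t {N = suc N} z≤n       t≈0 = sym (trans
    (+-cong (t≈0 0 z≤n) (sym (sum-extend (t ∘ suc) {N = N} z≤n (λ i _ → t≈0 (suc i) z≤n)))) (+-identityˡ 0#))
  sum-extend t             (s≤s m≤N) t≈0 = +-congˡ (sum-extend (t ∘ suc) m≤N (λ i m≤i → t≈0 (suc i) (s≤s m≤i)))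

  ⊛-vanishesˡ : ∀ f g n → (∀ i → i ≤ n → f i ≈ 0#) → (f ⊛ g) n ≈ 0#
  ⊛-vanishesˡ f g n f≈0 = trans (⊛-cong-≤ {g = g} n f≈0 (λ _ _ → refl)) (𝟘-⊛ g n)

  ⊛-vanishesʳ : ∀ f g n → (∀ i → i ≤ n → g i ≈ 0#) → (f ⊛ g) n ≈ 0#
  ⊛-vanishesʳ f g n g≈0 = trans (⊛-comm f g n) (⊛-vanishesˡ g f n g≈0)

  -- Without a constant term in `u`, the coefficient `f n` does not enter, so a strict bound
  -- suffices. With 1/x for `u` this is what lowers the index in the final induction.
  ⊛-vanishes-< : ∀ u f n → u 0 ≈ 0# → (∀ i → i < n → f i ≈ 0#) → (u ⊛ f) n ≈ 0#
  ⊛-vanishes-< u f zero    u₀ f≈0 = trans (+-congʳ (*-congʳ u₀)) (trans (+-identityʳ _) (zeroˡ _))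
  ⊛-vanishes-< u f (suc n) u₀ f≈0 = trans
    (+-cong (trans (*-congʳ u₀) (zeroˡ _)) (⊛-vanishesʳ (tail u) f n (λ i i≤n → f≈0 i (s≤s i≤n))))
    (+-identityˡ 0#)

  ^-vanishes : ∀ u → u 0 ≈ 0# → ∀ k n → n < k → (u ^ k) n ≈ 0#
  ^-vanishes u u₀ (suc k) n (s≤s n≤k) =
    ⊛-vanishes-< u (u ^ k) n u₀ (λ i i<n → ^-vanishes u u₀ k i (ℕ.<-≤-trans i<n n≤k))

  -- Only the product of `f 0` and `g n` survives. This passes from a coefficient of W = V U back to
  -- the same coefficient of U.
  unit-⊛-cancel : ∀ f g n → f 0 ≈ 1# → (∀ i → i < n → g i ≈ 0#) → (f ⊛ g) n ≈ g n
  unit-⊛-cancel f g zero    f₀ g≈0 = trans (+-identityʳ _) (trans (*-congʳ f₀) (*-identityˡ _))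
  unit-⊛-cancel f g (suc n) f₀ g≈0 = trans
    (+-cong (trans (*-congʳ f₀) (*-identityˡ _)) (⊛-vanishesʳ (tail f) g n (λ i i≤n → g≈0 i (s≤s i≤n))))
    (+-identityʳ _)

  module _ (e : ℕ → Carrier) where

    -- The number of summands grows with the coefficient, as in `log1+`, so this is not a single
    -- finite sum in the ring of series.
    logSeries : Series → Series
    logSeries u n = sum {n} (λ i → e (toℕ i) * (u ^ suc (toℕ i)) n)

    private
      term : Series → ℕ → Series
      term u i = constant (e i) ⊛ u ^ suc i

      term-coefficient : ∀ u i n → term u i n ≈ e i * (u ^ suc i) n
      term-coefficient u i n = constant-⊛ (e i) (u ^ suc i) n

      sum-cong : ∀ {m} {t t′ : Fin m → Carrier} → (∀ i → t i ≈ t′ i) → sum t ≈ sum t′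
      sum-cong = MonoidSum.sum-cong-≋ +-monoid

    -- Powers of `u` beyond the n-th do not reach coefficient `n`. One finite sum thus serves all
    -- coefficients up to `N`, and a derivation can be applied to it.
    logSeries-truncate : ∀ u → u 0 ≈ 0# → ∀ {n N} → n ≤ N →
                         logSeries u n ≈ BR.sum {N} (term u ∘ toℕ) n
    logSeries-truncate u u₀ {n} {N} n≤N = begin
      sum {n} (λ i → e (toℕ i) * (u ^ suc (toℕ i)) n)
        ≈⟨ sum-cong {n} (λ i → sym (term-coefficient u (toℕ i) n)) ⟩
      sum {n} ((λ i → term u i n) ∘ toℕ)
        ≈⟨ sum-extend (λ i → term u i n) n≤N (λ i n≤i → trans (term-coefficient u i n)
             (trans (*-congˡ (^-vanishes u u₀ (suc i) n (s≤s n≤i))) (zeroʳ (e i)))) ⟩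
      sum {N} (λ i → term u (toℕ i) n)
        ≈⟨ sum-coefficient {N} (term u ∘ toℕ) n ⟨
      BR.sum {N} (term u ∘ toℕ) n ∎

    -- The identity is checked one coefficient at a time on a truncation. This needs locality of
    -- `d`: a coefficient of `d f` depends only on the coefficient of `f` with the same index.
    logSeries-derivative : (ε : ℕ → Carrier) → (∀ k → suc k • e k ≈ ε k) → ε 0 ≈ 1# →
      (∀ k → ε k + ε (suc k) ≈ 0#) →
      ∀ {d} → IsDerivation commutativeRing d → (∀ {f g} n → f n ≈ g n → d f n ≈ d g n) →
      (∀ k → d (constant (e k)) ≋ 𝟘) →
      ∀ u → u 0 ≈ 0# → (constant 1# ⊕ u) ⊛ d (logSeries u) ≋ d u
    logSeries-derivative ε e-ε ε₀ ε-alternates {d} isDerivation d-local de u u₀ n = begin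
      ((constant 1# ⊕ u) ⊛ d (logSeries u)) n
        -- Truncating after `suc n` terms rather than `n` puts `u ^ suc n` into the remainder, which
        -- then vanishes up to index `n`.
        ≈⟨ ⊛-cong-≤ {f = constant 1# ⊕ u} n (λ _ _ → refl) (λ i i≤n → d-local {logSeries u} {ℓₙ} i (logSeries-truncate u u₀ (ℕ.m≤n⇒m≤1+n i≤n))) ⟩
      ((constant 1# ⊕ u) ⊛ d ℓₙ) n
        ≈⟨ trans (+-congˡ remainder≈0) (+-identityʳ _) ⟨
      ((constant 1# ⊕ u) ⊛ d ℓₙ) n + (constant (ε (suc n)) ⊛ (u ^ suc n ⊛ d u)) n
        ≈⟨ truncatedLog-derivative (constant ∘ e) (constant ∘ ε)
             (λ { k zero    → trans (multiple-coefficient (suc k) (constant (e k)) 0) (e-ε k)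
                ; k (suc j) → trans (multiple-coefficient (suc k) (constant (e k)) (suc j)) (•-zeroʳ (suc k)) })
             (λ { zero → ε₀ ; (suc _) → refl })
             (λ { k zero → ε-alternates k ; k (suc _) → +-identityˡ 0# })
             de u (suc n) n ⟩
      d u n ∎
      where
      open DerivationProperties commutativeRing isDerivation using (truncatedLog-derivative)
      ℓₙ = BR.sum {suc n} (term u ∘ toℕ)

      remainder≈0 : (constant (ε (suc n)) ⊛ (u ^ suc n ⊛ d u)) n ≈ 0#
      remainder≈0 = ⊛-vanishesʳ (constant (ε (suc n))) (u ^ suc n ⊛ d u) n λ i i≤n →
        ⊛-vanishesˡ (u ^ suc n) (d u) i λ j j≤i → ^-vanishes u u₀ (suc n) j (s≤s (ℕ.≤-trans j≤i i≤n))

-- Transfer from `A` to iterated power series, the induction, and the recurrences.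

module FormalSeriesRecurrences {c ℓ} (R : CommutativeRing c ℓ) (inv : PositiveIntegersInvertible R) where

  open FormalSeries R inv
  open PositiveIntegersInvertible inv

  private
    module R  = CommutativeRing R
    module RP = RingProperties R.ring
    module RM = SemiringMult R.semiring
    module RR = RawSemiringDefs (Semiring.rawSemiring R.semiring)
    module PR = PowerSeries R
    S = PR.commutativeRing
    module S  = CommutativeRing S
    module SM = SemiringMult S.semiring
    module SR = RawSemiringDefs (Semiring.rawSemiring S.semiring)
    module PS = PowerSeries S
    module LR = SeriesLogarithm R
    module LS = SeriesLogarithm S
    B = PS.commutativeRing
    module B  = CommutativeRing B

  -- Finiteness and degree bounds are forgotten: the image is a series in 1/x over series in y,
  -- where the ring laws are available. Equality in `A` is coefficientwise, so identities carry over
  -- in both directions.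
  φ : A → B.Carrier
  φ a n = coeff (coefficient a n)

  δ ∂ : B.Carrier → B.Carrier
  δ = PS.euler
  ∂ = PS.coefficientwise PR.derivative

  δ-isDerivation : IsDerivation B δ
  δ-isDerivation = PS.euler-isDerivation

  ∂-isDerivation : IsDerivation B ∂
  ∂-isDerivation = PS.coefficientwise-isDerivation PR.derivative-isDerivation

  δ∂≈∂δ : ∀ f → δ (∂ f) B.≈ ∂ (δ f)
  δ∂≈∂δ f n = S.sym {PR.derivative (n SM.× f n)} {n SM.× PR.derivative (f n)}
    (DerivationProperties.d-• S PR.derivative-isDerivation n (f n))

  sumₚ-coeff : ∀ {m} (t : Fin m → Poly) → coeff (sumₚ t) S.≈ SR.sum (coeff ∘ t)
  sumₚ-coeff {zero}  t j = R.refl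
  sumₚ-coeff {suc m} t j = R.+-congˡ (sumₚ-coeff (t ∘ fsuc) j)

  ×ₚ-coeff : ∀ n p j → coeff (n ×ₚ p) j R.≈ n RM.× coeff p j
  ×ₚ-coeff zero    p j = R.refl
  ×ₚ-coeff (suc n) p j = R.+-congˡ (×ₚ-coeff n p j)

  -- Both products are instances of `convolve`, so only taking coefficients of a finite sum of
  -- polynomials remains.
  φ-* : ∀ a b → φ (a *ₐ b) B.≈ φ a B.* φ b
  φ-* a b n = sumₚ-coeff {suc n} (λ i → coefficient a (toℕ i) *ₚ coefficient b (n ∸ toℕ i))

  φ-1 : φ 1ₐ B.≈ B.1#
  φ-1 zero    zero    = R.refl
  φ-1 zero    (suc j) = R.refl
  φ-1 (suc n) j       = R.refl

  φ-^ : ∀ u k → φ (u ^ₐ k) B.≈ φ u LS.^ k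
  φ-^ u zero    = φ-1
  φ-^ u (suc k) = B.trans {φ (u ^ₐ suc k)} {φ u B.* φ (u ^ₐ k)} {φ u B.* φ u LS.^ k}
    (φ-* u (u ^ₐ k)) (B.*-congˡ {φ u} {φ (u ^ₐ k)} {φ u LS.^ k} (φ-^ u k))

  s z : B.Carrier
  s = φ x⁻¹
  z = φ y/x

  s-*-suc : ∀ f n → (s B.* f) (suc n) S.≈ f n
  s-*-suc f n j = R.trans (R.+-congʳ (PR.𝟘-⊛ (f (suc n)) j)) (R.trans (R.+-identityˡ _)
    (B.trans {PS.tail s B.* f} {B.1# B.* f} {f}
      (B.*-congʳ {f} {PS.tail s} {B.1#} tail-s) (B.*-identityˡ f) n j))
    where
    tail-s : PS.tail s B.≈ B.1#
    tail-s zero    zero    = R.refl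
    tail-s zero    (suc j) = R.refl
    tail-s (suc n) j       = R.refl

  δs≈s : δ s B.≈ s
  δs≈s zero          j = R.refl
  δs≈s (suc zero)    j = R.+-identityʳ _
  δs≈s (suc (suc n)) j = PS.•-zeroʳ (suc (suc n)) j

  δz≈z : δ z B.≈ z
  δz≈z zero          j = R.refl
  δz≈z (suc zero)    j = R.+-identityʳ _
  δz≈z (suc (suc n)) j = PS.•-zeroʳ (suc (suc n)) j

  ∂s≈0 : ∂ s B.≈ B.0#
  ∂s≈0 zero          j = PR.•-zeroʳ (suc j)
  ∂s≈0 (suc zero)    j = PR.•-zeroʳ (suc j)
  ∂s≈0 (suc (suc n)) j = PR.•-zeroʳ (suc j)

  ∂z≈s : ∂ z B.≈ s
  ∂z≈s zero          j       = PR.•-zeroʳ (suc j)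
  ∂z≈s (suc zero)    zero    = R.+-identityʳ _
  ∂z≈s (suc zero)    (suc j) = PR.•-zeroʳ (suc (suc j))
  ∂z≈s (suc (suc n)) j       = PR.•-zeroʳ (suc j)

  -- Index `k` belongs to the power `k + 1` of the series, whose sign in `log1+` has exponent
  -- `k + 2`.
  sign reciprocal : ℕ → R.Carrier
  sign k       = (R.- R.1#) RR.^ suc (suc k)
  reciprocal k = sign k R.* recip (suc k)

  •-reciprocal : ∀ k → suc k RM.× reciprocal k R.≈ sign k
  •-reciprocal k = begin
    suc k RM.× (sign k R.* recip (suc k))            ≈⟨ RM.×-comm-* (suc k) (sign k) (recip (suc k)) ⟨
    sign k R.* (suc k RM.× recip (suc k))            ≈⟨ R.*-congˡ (RM.×-congʳ (suc k) (R.*-identityˡ _)) ⟨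
    sign k R.* (suc k RM.× (R.1# R.* recip (suc k))) ≈⟨ R.*-congˡ (RM.×-assoc-* (suc k) R.1# (recip (suc k))) ⟨
    sign k R.* ((suc k RM.× R.1#) R.* recip (suc k)) ≈⟨ R.*-congˡ (recip-inverse (suc k)) ⟩
    sign k R.* R.1#                                  ≈⟨ R.*-identityʳ (sign k) ⟩
    sign k                                           ∎
    where open import Relation.Binary.Reasoning.Setoid R.setoid

  sign-0 : sign 0 R.≈ R.1#
  sign-0 = R.trans (RP.-1*x≈-x _) (R.trans (R.-‿cong (R.*-identityʳ _)) (RP.-‿involutive R.1#))

  sign-alternates : ∀ k → sign k R.+ sign (suc k) R.≈ R.0#
  sign-alternates k = R.trans (R.+-congˡ (RP.-1*x≈-x (sign k))) (R.-‿inverseʳ (sign k))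

  e ε : ℕ → S.Carrier
  e = PR.constant ∘ reciprocal
  ε = PR.constant ∘ sign

  log1+≈logSeries : ∀ u u₀ → φ (log1+ u u₀) B.≈ LS.logSeries e (φ u)
  log1+≈logSeries u u₀ n = S.trans {φ (log1+ u u₀) n} {SR.sum {n} (coeff ∘ t)} {LS.logSeries e (φ u) n}
    (sumₚ-coeff {n} t) (MonoidSum.sum-cong-≋ S.+-monoid {n} λ i j → R.sym (R.trans
      (PR.constant-⊛ (reciprocal (toℕ i)) ((φ u LS.^ suc (toℕ i)) n) j)
      (R.*-congˡ (R.sym (φ-^ u (suc (toℕ i)) n j)))))
    where
    t : Fin n → Poly
    t i = reciprocal (toℕ i) ·ₚ coefficient (u ^ₐ suc (toℕ i)) n

  module _ (V : A) (V₀ : UnitConstantTerm V) where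

    private
      v lnV u : B.Carrier
      v   = φ V
      lnV = φ (log V V₀)
      u   = φ (V -ₐ 1ₐ)

      1+u≈v : B.1# B.+ u B.≈ v
      1+u≈v n j = begin
        B.1# n j R.+ (v n j R.- φ 1ₐ n j)   ≈⟨ R.+-congˡ (R.+-congˡ (R.-‿cong (φ-1 n j))) ⟩
        B.1# n j R.+ (v n j R.- B.1# n j)   ≈⟨ R.+-assoc _ _ _ ⟨
        (B.1# n j R.+ v n j) R.- B.1# n j   ≈⟨ xyx⁻¹≈y (B.1# n j) (v n j) ⟩
        v n j                               ∎
        where
        open import Relation.Binary.Reasoning.Setoid R.setoid
        open AbelianGroupProperties R.+-abelianGroup using (xyx⁻¹≈y)

    u₀≈0 : u 0 S.≈ S.0#
    u₀≈0 j = R.trans (R.+-congʳ (V₀ j)) (R.-‿inverseʳ (coeff 1ₚ j))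

    -- Write V = 1 + u and use d 1 = 0. Stated for a general `d` so as to cover both `∂` and `δ`.
    log-derivative : ∀ {d} → IsDerivation B d → (∀ {f g} n → f n S.≈ g n → d f n S.≈ d g n) →
                     (∀ k → d (PS.constant (e k)) B.≈ B.0#) → v B.* d lnV B.≈ d v
    log-derivative {d} isDerivation d-local de = begin
      v B.* d lnV                               ≈⟨ B.*-cong {v} {B.1# B.+ u} {d lnV} {d (LS.logSeries e u)}
                                                     (B.sym {B.1# B.+ u} {v} 1+u≈v)
                                                     (d.cong (log1+≈logSeries (V -ₐ 1ₐ) u₀≈0)) ⟩
      (B.1# B.+ u) B.* d (LS.logSeries e u)     ≈⟨ LS.logSeries-derivative e ε e-ε ε₀ ε-alternates
                                                     isDerivation d-local de u u₀≈0 ⟩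
      d u                                       ≈⟨ B.+-identityˡ (d u) ⟨
      B.0# B.+ d u                              ≈⟨ B.+-congʳ {d u} {d B.1#} {B.0#}
                                                     (DerivationProperties.d1≈0 B isDerivation) ⟨
      d B.1# B.+ d u                            ≈⟨ d.+-homo B.1# u ⟨
      d (B.1# B.+ u)                            ≈⟨ d.cong 1+u≈v ⟩
      d v                                       ∎
      where
      module d = IsDerivation isDerivation
      open import Relation.Binary.Reasoning.Setoid B.setoid

      e-ε : ∀ k → suc k SM.× e k S.≈ ε k
      e-ε k zero    = R.trans (LR.multiple-coefficient (suc k) (e k) 0) (•-reciprocal k)
      e-ε k (suc j) = R.trans (LR.multiple-coefficient (suc k) (e k) (suc j)) (PR.•-zeroʳ (suc k))

      ε₀ : ε 0 S.≈ S.1#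
      ε₀ zero    = sign-0
      ε₀ (suc j) = R.refl

      ε-alternates : ∀ k → ε k S.+ ε (suc k) S.≈ S.0#
      ε-alternates k zero    = sign-alternates k
      ε-alternates k (suc j) = R.+-identityˡ R.0#

    v-∂log : v B.* ∂ lnV B.≈ ∂ v
    v-∂log = log-derivative ∂-isDerivation
      (λ {f} {g} n → IsDerivation.cong PR.derivative-isDerivation {f n} {g n})
      (λ k → PS.coefficientwise-constant PR.derivative-isDerivation {e k} (PR.derivative-constant (reciprocal k)))

    v-δlog : v B.* δ lnV B.≈ δ v
    v-δlog = log-derivative δ-isDerivation (λ {f} {g} n → SM.×-congʳ n {f n} {g n}) (λ k → PS.euler-constant (e k))

    -- With s = 1/x and δ = -x ∂/∂x, the product s δ is -∂/∂x.
    -∂x≈sδ : ∀ n j → R.- φ (∂x V) n j R.≈ (s B.* δ v) n j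
    -∂x≈sδ zero    j = R.trans RP.-0#≈0# (R.sym (LS.⊛-vanishes-< s (δ v) 0 (λ _ → R.refl) (λ _ ()) j))
    -∂x≈sδ (suc n) j = begin
      R.- (R.- coeff (n ×ₚ coefficient V n) j) ≈⟨ RP.-‿involutive _ ⟩
      coeff (n ×ₚ coefficient V n) j           ≈⟨ ×ₚ-coeff n (coefficient V n) j ⟩
      n RM.× v n j                             ≈⟨ LR.multiple-coefficient n (v n) j ⟨
      δ v n j                                  ≈⟨ s-*-suc (δ v) n j ⟨
      (s B.* δ v) (suc n) j                    ∎
      where open import Relation.Binary.Reasoning.Setoid R.setoid

    module _ (equation : Equation V V₀) where

      B-equation : v B.+ s B.* v B.+ s B.* ∂ v B.≈ B.1# B.+ z B.+ s B.* δ v B.+ s B.* lnV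
      B-equation n j = begin
        v n j R.+ a R.+ c′
          ≈⟨ R.+-congʳ (R.+-congʳ (equation n j)) ⟩
        φ 1ₐ n j R.+ z n j R.- φ (x⁻¹ *ₐ V) n j R.- φ (∂x V) n j R.- φ (x⁻¹ *ₐ ∂y V) n j R.+ φ (x⁻¹ *ₐ log V V₀) n j
          R.+ a R.+ c′
          ≈⟨ R.+-congʳ (R.+-congʳ (R.+-cong (R.+-cong (R.+-cong (R.+-cong (R.+-congʳ (φ-1 n j))
               (R.-‿cong (φ-* x⁻¹ V n j))) (-∂x≈sδ n j)) (R.-‿cong (φ-* x⁻¹ (∂y V) n j))) (φ-* x⁻¹ (log V V₀) n j))) ⟩
        o R.+ z n j R.- a R.+ b R.- c′ R.+ l R.+ a R.+ c′
          -- The negatives enter the semiring solver as independent variables and are cancelled in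
          -- the next step.
          ≈⟨ solve 8 (λ o z a a⁻ b c c⁻ l → o :+ z :+ a⁻ :+ b :+ c⁻ :+ l :+ a :+ c
               := o :+ z :+ b :+ l :+ (a⁻ :+ a) :+ (c⁻ :+ c)) R.refl o (z n j) a (R.- a) b c′ (R.- c′) l ⟩
        o R.+ z n j R.+ b R.+ l R.+ (R.- a R.+ a) R.+ (R.- c′ R.+ c′)
          ≈⟨ R.+-cong (R.+-congˡ (R.-‿inverseˡ a)) (R.-‿inverseˡ c′) ⟩
        o R.+ z n j R.+ b R.+ l R.+ R.0# R.+ R.0#
          ≈⟨ R.trans (R.+-identityʳ _) (R.+-identityʳ _) ⟩
        o R.+ z n j R.+ b R.+ l ∎
        where
        open import Relation.Binary.Reasoning.Setoid R.setoid
        open SemiringSolver R.commutativeSemiring using (solve; _:=_; _:+_)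
        o  = B.1# n j
        a  = (s B.* v) n j
        b  = (s B.* δ v) n j
        c′ = (s B.* ∂ v) n j
        l  = (s B.* lnV) n j

      open FunctionalEquation.Solution B δ-isDerivation ∂-isDerivation δ∂≈∂δ {s} {z} {v} {lnV}
        δs≈s ∂s≈0 δz≈z ∂z≈s v-∂log v-δlog B-equation

      private
        v₀≈1 : v 0 S.≈ S.1#
        v₀≈1 zero    = V₀ zero
        v₀≈1 (suc j) = V₀ (suc j)

        s*-vanishes : ∀ n f → (∀ i → i < n → f i S.≈ S.0#) → (s B.* f) n S.≈ S.0#
        s*-vanishes n f = LS.⊛-vanishes-< s f n (λ _ → R.refl)

        W-vanishes : ∀ n → (∀ i → i ≤ n → U i S.≈ S.0#) → W n S.≈ S.0#
        W-vanishes n = LS.⊛-vanishesʳ v U n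

      -- In `W-equation` every term except the leading `W` carries a factor `s`, hence at index `n`
      -- involves only lower coefficients of `U` and `W`. The latter vanish with those of `U`, so
      -- `W n` vanishes, and it equals `U n`.
      U-step : ∀ n → (∀ i → i < n → U i S.≈ S.0#) → U n S.≈ S.0#
      U-step n U≈0 = begin
        U n                                          ≈⟨ LS.unit-⊛-cancel v U n v₀≈1 U≈0 ⟨
        W n                                          ≈⟨ S.+-identityʳ (W n) ⟨
        W n S.+ S.0#                                 ≈⟨ S.+-identityʳ (W n S.+ S.0#) ⟨
        W n S.+ S.0# S.+ S.0#                        ≈⟨ (λ j → R.+-cong (R.+-congˡ (s*-vanishes n W W≈0 j))
                                                          (s*-vanishes n (∂ W) ∂W≈0 j)) ⟨
        W n S.+ (s B.* W) n S.+ (s B.* ∂ W) n        ≈⟨ W-equation n ⟩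
        (s B.* δ W) n S.+ (s B.* U) n                ≈⟨ (λ j → R.+-cong (s*-vanishes n (δ W) δW≈0 j)
                                                          (s*-vanishes n U U≈0 j)) ⟩
        S.0# S.+ S.0#                                ≈⟨ S.+-identityˡ S.0# ⟩
        S.0#                                         ∎
        where
        open import Relation.Binary.Reasoning.Setoid S.setoid
        W≈0 : ∀ i → i < n → W i S.≈ S.0#
        W≈0 i i<n = W-vanishes i (λ k k≤i → U≈0 k (ℕ.≤-<-trans k≤i i<n))
        δW≈0 : ∀ i → i < n → δ W i S.≈ S.0#
        δW≈0 i i<n = S.trans {δ W i} {i SM.× S.0#} {S.0#} (SM.×-congʳ i {W i} {S.0#} (W≈0 i i<n)) (PS.•-zeroʳ i)
        ∂W≈0 : ∀ i → i < n → ∂ W i S.≈ S.0#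
        ∂W≈0 i i<n j = R.trans (RM.×-congʳ (suc j) (W≈0 i i<n (suc j))) (PR.•-zeroʳ (suc j))

      U≈0 : U B.≈ B.0#
      U≈0 = <-rec (λ n → U n S.≈ S.0#) λ n ih → U-step n (λ i i<n → ih i<n)

      W≈0 : W B.≈ B.0#
      W≈0 n = W-vanishes n (λ i _ → U≈0 i)

      -- This is W = 0 read at index `suc n`, where the factors `s` shift the index down by one.
      V-recurrence : ∀ n j → ∂ v n j R.+ v n j R.≈ n RM.× v n j R.+ ∂ v (suc n) j
      V-recurrence n j = begin
        ∂ v n j R.+ v n j
          ≈⟨ R.+-cong (s-*-suc (∂ v) n j) (s-*-suc v n j) ⟨
        (s B.* ∂ v B.+ s B.* v) (suc n) j
          ≈⟨ R.+-identityˡ _ ⟨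
        R.0# R.+ (s B.* ∂ v B.+ s B.* v) (suc n) j
          ≈⟨ R.+-congʳ (W≈0 (suc n) j) ⟨
        W (suc n) j R.+ (s B.* ∂ v B.+ s B.* v) (suc n) j
          ≈⟨ W-relation (suc n) j ⟩
        (s B.* δ v B.+ ∂ v) (suc n) j
          ≈⟨ R.+-congʳ (R.trans (s-*-suc (δ v) n j) (LR.multiple-coefficient n (v n) j)) ⟩
        n RM.× v n j R.+ ∂ v (suc n) j ∎
        where open import Relation.Binary.Reasoning.Setoid R.setoid

      -- This is U = 0 read at index `suc n`. The inhomogeneous term `s (suc n)` is nonzero only for
      -- n = 0, which is why the recurrence for Q starts one step later.
      log-recurrence : ∀ n j → ∂ lnV n j R.+ s (suc n) j R.≈ n RM.× lnV n j R.+ ∂ lnV (suc n) j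
      log-recurrence n j = begin
        ∂ lnV n j R.+ s (suc n) j
          ≈⟨ R.+-congʳ (s-*-suc (∂ lnV) n j) ⟨
        (s B.* ∂ lnV B.+ s) (suc n) j
          ≈⟨ R.+-identityˡ _ ⟨
        R.0# R.+ (s B.* ∂ lnV B.+ s) (suc n) j
          ≈⟨ R.+-congʳ (U≈0 (suc n) j) ⟨
        U (suc n) j R.+ (s B.* ∂ lnV B.+ s) (suc n) j
          ≈⟨ U-relation (suc n) j ⟩
        (s B.* δ lnV B.+ ∂ lnV) (suc n) j
          ≈⟨ R.+-congʳ (R.trans (s-*-suc (δ lnV) n j) (LR.multiple-coefficient n (lnV n) j)) ⟩
        n RM.× lnV n j R.+ ∂ lnV (suc n) j ∎
        where open import Relation.Binary.Reasoning.Setoid R.setoid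

      P-recurrence : ∀ n → n ×ₚ P V n ≈ₚ P V n ′ -ₚ P V (suc n) ′
      -- `P V n` is the coefficient of index `suc n`, so the multiple in `V-recurrence` is `suc n`;
      -- one copy cancels against the undifferentiated term.
      P-recurrence n j = R.trans (×ₚ-coeff n (P V n) j) (x≈z//y _ _ _ (RP.+-cancelˡ (v (suc n) j) _ _ (begin
        v (suc n) j R.+ (n RM.× v (suc n) j R.+ ∂ v (suc (suc n)) j) ≈⟨ R.+-assoc _ _ _ ⟨
        suc n RM.× v (suc n) j R.+ ∂ v (suc (suc n)) j               ≈⟨ V-recurrence (suc n) j ⟨
        ∂ v (suc n) j R.+ v (suc n) j                                ≈⟨ R.+-comm _ _ ⟩
        v (suc n) j R.+ ∂ v (suc n) j                                ∎)))
        where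
        open import Relation.Binary.Reasoning.Setoid R.setoid
        open GroupProperties R.+-group using (x≈z//y)

      Q-recurrence : ∀ n → suc n ×ₚ Q V V₀ (suc n) ≈ₚ Q V V₀ (suc n) ′ -ₚ Q V V₀ (suc (suc n)) ′
      Q-recurrence n j = R.trans (×ₚ-coeff (suc n) (Q V V₀ (suc n)) j)
        -- The identity law applies because `s (suc (suc n))` computes to zero.
        (x≈z//y _ _ _ (R.trans (R.sym (log-recurrence (suc n) j)) (R.+-identityʳ _)))
        where open GroupProperties R.+-group using (x≈z//y)

open import Defs

theorem4p6 : (V : A) (V₀ : UnitConstantTerm V) → Equation V V₀ →
    ((n : ℕ) → 1 ≤ n → (n ∸ 1) ×ₚ P V (n ∸ 1) ≈ₚ P V (n ∸ 1) ′ -ₚ P V n ′) ×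
    ((n : ℕ) → 2 ≤ n → (n ∸ 1) ×ₚ Q V V₀ (n ∸ 1) ≈ₚ Q V V₀ (n ∸ 1) ′ -ₚ Q V V₀ n ′)
theorem4p6 V V₀ equation =
  (λ { (suc n) _ → P-recurrence V V₀ equation n }) ,
  (λ { (suc (suc n)) _ → Q-recurrence V V₀ equation n ; (suc zero) (s≤s ()) })
  where open FormalSeriesRecurrences ℂ-commutativeRing ℂ-positiveIntegersInvertible
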